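{- Let $G$ be a finite simple graph with at least one edge. The following statements are equivalent: (1) $G$ has a matching that saturates every vertex of $\mathrm{core}(G)$. (2) $G$ has a mitigating set of minimum size which is a matching. (3) For every $S\subseteq \mathrm{core}(G)$, $\mathrm{es}_{\Delta}(G[N[S]])\le \frac{|N[S]|}{2}$.
   Context: $\Delta(G)$ denotes the maximum degree of $G$, and $\mathrm{core}(G)$ is the set of vertices of $G$ of degree $\Delta(G)$. A set $S\subseteq E(G)$ is a mitigating set if $\Delta(G-S)\le\Delta(G)-1$. The $\Delta$-edge stability number $\mathrm{es}_{\Delta}(G)$ is the minimum number of edges whose removal results in a subgraph $H$ with $\Delta(H)=\Delta(G)-1$ (the minimum size of a mitigating set). For $S\subseteq V(G)$, $N[S]=\bigcup_{v\in S}(N(v)\cup\{v\})$ is the closed neighborhood of $S$ and $G[N[S]]$ the subgraph induced by it. -}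

module Defs where

open import Data.Nat using (ℕ; zero; suc; _+_; _*_; _∸_; _≤_; _⊔_)
open import Data.Bool using (Bool; true; false; _∧_; _∨_; not; if_then_else_)
open import Data.Bool.Properties using (∧-comm)
open import Data.Fin using (Fin; toℕ)
open import Data.Nat using (_<ᵇ_)
open import Data.List using (List; map; foldr; allFin)
open import Data.Nat.ListAction using (sum)
open import Data.Product using (Σ; _×_; _,_; ∃; ∃-syntax)
open import Relation.Binary.PropositionalEquality using (_≡_; refl; cong₂)

record Graph (n : ℕ) : Set where
  field
    adj    : Fin n → Fin n → Bool
    sym    : ∀ i j → adj i j ≡ adj j i
    irrefl : ∀ i → adj i i ≡ false
open Graph public

count : {n : ℕ} → (Fin n → Bool) → ℕ
count {n} p = sum (map (λ u → if p u then 1 else 0) (allFin n))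

degA : {n : ℕ} → (Fin n → Fin n → Bool) → Fin n → ℕ
degA A v = count (A v)

ΔA : {n : ℕ} → (Fin n → Fin n → Bool) → ℕ
ΔA {n} A = foldr _⊔_ 0 (map (degA A) (allFin n))

deg : {n : ℕ} → Graph n → Fin n → ℕ
deg G = degA (adj G)

Δ : {n : ℕ} → Graph n → ℕ
Δ G = ΔA (adj G)

InCore : {n : ℕ} → Graph n → Fin n → Set
InCore G v = deg G v ≡ Δ G

HasEdge : {n : ℕ} → Graph n → Set
HasEdge G = ∃[ i ] ∃[ j ] (adj G i j ≡ true)

-- A set of edges of G: a symmetric Boolean relation contained in adj G
-- (each edge {i,j} is recorded in both orientations).
record EdgeSet {n : ℕ} (G : Graph n) : Set where
  field
    mem     : Fin n → Fin n → Bool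
    memSym  : ∀ i j → mem i j ≡ mem j i
    memAdj  : ∀ i j → mem i j ≡ true → adj G i j ≡ true
open EdgeSet public

size : {n : ℕ} {G : Graph n} → EdgeSet G → ℕ
size {n} S = sum (map (λ i → count (λ j → mem S i j ∧ (toℕ i <ᵇ toℕ j))) (allFin n))

removeA : {n : ℕ} {G : Graph n} → EdgeSet G → Fin n → Fin n → Bool
removeA {G = G} S i j = adj G i j ∧ not (mem S i j)

Mitigating : {n : ℕ} (G : Graph n) → EdgeSet G → Set
Mitigating G S = ΔA (removeA S) ≤ Δ G ∸ 1

MinMitigating : {n : ℕ} (G : Graph n) → EdgeSet G → Set
MinMitigating G S = Mitigating G S × (∀ (T : EdgeSet G) → Mitigating G T → size S ≤ size T)

IsEsΔ : {n : ℕ} → Graph n → ℕ → Set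
IsEsΔ G k = Σ (EdgeSet G) (λ S → MinMitigating G S × size S ≡ k)

IsMatching : {n : ℕ} {G : Graph n} → EdgeSet G → Set
IsMatching {n} S = ∀ (v : Fin n) → degA (mem S) v ≤ 1

Saturates : {n : ℕ} {G : Graph n} → EdgeSet G → Fin n → Set
Saturates M v = 1 ≤ degA (mem M) v

VSet : ℕ → Set
VSet n = Fin n → Bool

_⊆core_ : {n : ℕ} → VSet n → Graph n → Set
_⊆core_ {n} S G = ∀ (v : Fin n) → S v ≡ true → InCore G v

any? : {n : ℕ} → (Fin n → Bool) → Bool
any? {n} p = foldr _∨_ false (map p (allFin n))

closedNbhd : {n : ℕ} → Graph n → VSet n → VSet n
closedNbhd G S v = S v ∨ any? (λ u → S u ∧ adj G u v)

-- induced subgraph G[X], represented on the same vertex set Fin n with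
-- all vertices outside X isolated
induced : {n : ℕ} → Graph n → VSet n → Graph n
induced G X = record
  { adj    = λ i j → adj G i j ∧ (X i ∧ X j)
  ; sym    = λ i j → cong₂ _∧_ (sym G i j) (∧-comm (X i) (X j))
  ; irrefl = λ i → cong₂ _∧_ (irrefl G i) refl
  }

Cond1 : {n : ℕ} → Graph n → Set
Cond1 {n} G = Σ (EdgeSet G) (λ M → IsMatching M × (∀ (v : Fin n) → InCore G v → Saturates M v))

Cond2 : {n : ℕ} → Graph n → Set
Cond2 G = Σ (EdgeSet G) (λ S → MinMitigating G S × IsMatching S)

Cond3 : {n : ℕ} → Graph n → Set
Cond3 G = ∀ (S : VSet _) → S ⊆core G → ∀ (k : ℕ) →
  IsEsΔ (induced G (closedNbhd G S)) k → 2 * k ≤ count (closedNbhd G S)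

{-# OPTIONS --safe #-}

-- As Δ(G) ≥ 1, a set of edges is mitigating iff it covers core(G).
--
-- (1) ⇒ (2): let M be a matching covering the core and S any cover of the core.
-- If a vertex v has two S-neighbours, one of them, u, is not M-adjacent to v;
-- replacing vu by the M-edge at u keeps the core covered, does not enlarge S and
-- decreases |S ∖ M|.  So a smallest cover can be turned into a matching.
--
-- (1) ⇒ (3): a vertex of maximum degree in H = G[N[S]], S nonempty, lies in
-- core(G) and has all its neighbours in N[S], so M restricted to H covers
-- core(H), and a matching inside N[S] has at most |N[S]|/2 edges.
--
-- (3) ⇒ (1): a local-exchange version of the Gallai–Edmonds argument.  If no
-- matching saturates the core C, choose a maximal set U for which the least
-- number K of vertices of C ∖ U missed by a matching of G − U exceeds |U|, each
-- step raising both by one.  Let D be the set of vertices of C ∖ U missed by some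
-- optimal matching of G − U.  By maximality all neighbours of D lie in D ∪ U, and
-- "no optimal matching misses both d and u" is an equivalence relation on D whose
-- classes are closed under adjacency in G − U.  An optimal matching M misses K
-- vertices, all in different classes.  Let F be a cover of D in G[N[D]]; if F
-- matched the class of an M-missed vertex perfectly, F could replace M there and
-- M would not be optimal.  So each of these K classes has a vertex d with
-- deg_F(d) + |N_F(d) ∩ U| ≥ 2, whence 2|F| ≥ |D| + K > |D| + |U| ≥ |N[D]|,
-- against (3) for S = D.
module Submission where

open import Defs
open import Data.Nat using (ℕ)
open import Data.Product using (_×_)
open import Function.Bundles using (_⇔_)

open import Algebra.Properties.CommutativeMonoid.Sum using ()
open import Data.Bool using (Bool; true; false; _∧_; _∨_; not; if_then_else_; T)
open import Data.Bool.Properties using (T?; T-≡; T-∧; T-∨)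
open import Data.Empty using (⊥-elim)
open import Data.Fin as Fin using (Fin; zero; suc; toℕ; combine; remQuot)
open import Data.Fin.Subset.Properties using (anySubset?)
open import Data.Fin.Properties as Fin using (_≟_)
open import Data.List using (foldr; map; allFin; tabulate; _∷_; [])
open import Data.List.Membership.Propositional using () renaming (_∈_ to _∈ᴸ_)
open import Data.List.Membership.Propositional.Properties using (∈-allFin)
open import Data.List.Relation.Unary.Any using (here; there)
open import Data.List.Properties using (map-cong; map-tabulate)
open import Data.Nat using (zero; suc; _+_; _*_; _∸_; _≤_; _<_; z≤n; s≤s; _≤?_; _<?_; _<ᵇ_; _⊔_)
open import Data.Nat.ListAction using (sum)
open import Data.Nat.Properties as ℕ hiding (_≟_; _≤?_; _<?_)
open import Data.Product using (_,_; ∃; ∃-syntax; proj₁; proj₂)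
open import Data.Sum using (_⊎_; inj₁; inj₂; [_,_]′)
open import Data.Vec as Vec using (Vec; lookup)
open import Data.Vec.Properties using (lookup∘tabulate)
open import Data.Unit using (tt)
open import Function using (_∘_; id; case_of_)
open import Function.Bundles using (Equivalence; mk⇔)
open import Relation.Binary.Definitions using (tri<; tri≈; tri>)
open import Relation.Binary.PropositionalEquality as ≡ using (_≡_; _≢_; refl; cong; cong₂; subst)
open import Relation.Nullary using (¬_; Dec; yes; no; does; contradiction; ¬?)
open import Relation.Nullary.Decidable using (map′; _×-dec_; _⊎-dec_; _→-dec_; dec-true; dec-false; decidable-stable; isYes; toWitness; fromWitness; ¬¬-excluded-middle)
open import Relation.Nullary.Negation using (¬¬-map)
open import Relation.Unary using (Decidable)

-- Finite sums and counting

module VF = Algebra.Properties.CommutativeMonoid.Sum ℕ.+-0-commutativeMonoid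

-- Opaque so that the summand can be inferred from a goal.
opaque
  ∑ : ∀ {n} → (Fin n → ℕ) → ℕ
  ∑ {n} f = sum (map f (allFin n))

  ∑-unfold : ∀ {n} (f : Fin n → ℕ) → sum (map f (allFin n)) ≡ ∑ f
  ∑-unfold f = refl

  ∑≡sum : ∀ {n} (f : Fin n → ℕ) → ∑ f ≡ VF.sum f
  ∑≡sum f = ≡.trans (cong sum (map-tabulate id f)) (sum-tabulate f)
    where
    sum-tabulate : ∀ {n} (f : Fin n → ℕ) → sum (tabulate f) ≡ VF.sum f
    sum-tabulate {zero}  f = refl
    sum-tabulate {suc n} f = cong (f zero +_) (sum-tabulate (f ∘ suc))

∑-suc : ∀ {n} (f : Fin (suc n) → ℕ) → ∑ f ≡ f zero + ∑ (f ∘ suc)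
∑-suc f = ≡.trans (∑≡sum f) (cong (f zero +_) (≡.sym (∑≡sum (f ∘ suc))))

∑-mono : ∀ {n} {f g : Fin n → ℕ} → (∀ i → f i ≤ g i) → ∑ f ≤ ∑ g
∑-mono {zero}  {f} {g} f≤g = ≤-reflexive (≡.trans (∑≡sum f) (≡.sym (∑≡sum g)))
∑-mono {suc n} {f} {g} f≤g =
  ≡.subst₂ _≤_ (≡.sym (∑-suc f)) (≡.sym (∑-suc g)) (+-mono-≤ (f≤g zero) (∑-mono (f≤g ∘ suc)))

∑-cong : ∀ {n} {f g : Fin n → ℕ} → (∀ i → f i ≡ g i) → ∑ f ≡ ∑ g
∑-cong f≗g = ≤-antisym (∑-mono (≤-reflexive ∘ f≗g)) (∑-mono (≤-reflexive ∘ ≡.sym ∘ f≗g))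

∑-+ : ∀ {n} (f g : Fin n → ℕ) → ∑ (λ i → f i + g i) ≡ ∑ f + ∑ g
∑-+ f g = ≡.trans (∑≡sum _) (≡.trans (VF.∑-distrib-+ f g) (cong₂ _+_ (≡.sym (∑≡sum f)) (≡.sym (∑≡sum g))))

∑-comm : ∀ {m n} (f : Fin m → Fin n → ℕ) → ∑ (λ i → ∑ (f i)) ≡ ∑ (λ j → ∑ (λ i → f i j))
∑-comm f = begin
  ∑ (λ i → ∑ (f i))                    ≡⟨ ∑-cong (λ i → ∑≡sum (f i)) ⟩
  ∑ (λ i → VF.sum (f i))               ≡⟨ ∑≡sum _ ⟩
  VF.sum (λ i → VF.sum (f i))          ≡⟨ VF.∑-comm f ⟩
  VF.sum (λ j → VF.sum (λ i → f i j))  ≡⟨ ∑≡sum _ ⟨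
  ∑ (λ j → VF.sum (λ i → f i j))       ≡⟨ ∑-cong (λ j → ∑≡sum (λ i → f i j)) ⟨
  ∑ (λ j → ∑ (λ i → f i j))            ∎
  where open ≡.≡-Reasoning

∑-zero : ∀ {n} {f : Fin n → ℕ} → (∀ i → f i ≡ 0) → ∑ f ≡ 0
∑-zero {zero}  {f} f≗0 = ∑≡sum f
∑-zero {suc n} {f} f≗0 = ≡.trans (∑-suc f) (cong₂ _+_ (f≗0 zero) (∑-zero (f≗0 ∘ suc)))

single≤∑ : ∀ {n} (f : Fin n → ℕ) i → f i ≤ ∑ f
single≤∑ f zero    = ≤-trans (m≤m+n _ _) (≤-reflexive (≡.sym (∑-suc f)))
single≤∑ f (suc i) = ≤-trans (single≤∑ (f ∘ suc) i) (≤-trans (m≤n+m _ _) (≤-reflexive (≡.sym (∑-suc f))))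

𝟙 : ∀ {P : Set} → Dec P → ℕ
𝟙 P? = if does P? then 1 else 0

𝟙-true : ∀ {P : Set} (P? : Dec P) → P → 𝟙 P? ≡ 1
𝟙-true P? p rewrite dec-true P? p = refl

𝟙-false : ∀ {P : Set} (P? : Dec P) → ¬ P → 𝟙 P? ≡ 0
𝟙-false P? ¬p rewrite dec-false P? ¬p = refl

𝟙-cases : ∀ {P : Set} (B : ℕ → Set) (P? : Dec P) → (P → B 1) → (¬ P → B 0) → B (𝟙 P?)
𝟙-cases B (yes p) b₁ b₀ = b₁ p
𝟙-cases B (no ¬p) b₁ b₀ = b₀ ¬p

𝟙≤1 : ∀ {P : Set} (P? : Dec P) → 𝟙 P? ≤ 1
𝟙≤1 (yes _) = ≤-refl
𝟙≤1 (no _)  = z≤n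

# : ∀ {n} {P : Fin n → Set} → Decidable P → ℕ
# P? = ∑ (λ v → 𝟙 (P? v))

∑-point : ∀ {n} (a : Fin n) → # (_≟ a) ≡ 1
∑-point zero    = ≡.trans (∑-suc (λ v → 𝟙 (v ≟ zero))) (cong suc (∑-zero {f = λ v → 𝟙 (suc v ≟ zero)} (λ _ → refl)))
∑-point (suc a) = ≡.trans (∑-suc (λ v → 𝟙 (v ≟ suc a))) (≡.trans (∑-cong {f = λ v → 𝟙 (suc v ≟ suc a)} (λ v → refl)) (∑-point a))

-- `f` may exceed `g` where `k` exceeds `h`; the correction terms cancel after summation because
-- `∑ k` is at most `∑ h`.
∑-shift : ∀ {n} (f g : Fin n → ℕ) {h k : Fin n → ℕ} → ∑ k ≤ ∑ h →
          (∀ i → f i + h i ≤ g i + k i) → ∑ f ≤ ∑ g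
∑-shift f g {h} {k} k≤h f+h≤g+k = +-cancelʳ-≤ (∑ h) _ _ (begin
  ∑ f + ∑ h            ≡⟨ ∑-+ f h ⟨
  ∑ (λ i → f i + h i)  ≤⟨ ∑-mono f+h≤g+k ⟩
  ∑ (λ i → g i + k i)  ≡⟨ ∑-+ g k ⟩
  ∑ g + ∑ k            ≤⟨ +-monoʳ-≤ _ k≤h ⟩
  ∑ g + ∑ h            ∎)
  where open ≤-Reasoning

∑-mono-< : ∀ {n} (f g : Fin n → ℕ) (i : Fin n) → (∀ j → f j ≤ g j) → f i < g i → ∑ f < ∑ g
∑-mono-< f g i f≤g fi<gi = begin
  suc (∑ f)                   ≡⟨ +-comm 1 _ ⟩
  ∑ f + 1                     ≡⟨ cong (∑ f +_) (∑-point i) ⟨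
  ∑ f + # (_≟ i)              ≡⟨ ∑-+ _ _ ⟨
  ∑ (λ j → f j + 𝟙 (j ≟ i))   ≤⟨ ∑-mono pointwise ⟩
  ∑ g                         ∎
  where
  open ≤-Reasoning
  pointwise : ∀ j → f j + 𝟙 (j ≟ i) ≤ g j
  pointwise j with j ≟ i
  ... | yes refl = ≤-trans (≤-reflexive (+-comm _ 1)) fi<gi
  ... | no _     = ≤-trans (≤-reflexive (+-identityʳ _)) (f≤g j)

module _ {n : ℕ} {P Q : Fin n → Set} (P? : Decidable P) (Q? : Decidable Q) where

  #-exchange : ∀ {x z} → (∀ v → P v → Q v ⊎ v ≡ z) → Q x → ¬ P x → # P? ≤ # Q?
  #-exchange {x} {z} P⇒Q Qx ¬Px =
    ∑-shift _ _ (≤-reflexive (≡.trans (∑-point z) (≡.sym (∑-point x)))) pointwise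
    where
    pointwise : ∀ v → 𝟙 (P? v) + 𝟙 (v ≟ x) ≤ 𝟙 (Q? v) + 𝟙 (v ≟ z)
    pointwise v with P? v | v ≟ x
    ... | no _  | no _     = z≤n
    ... | no _  | yes refl = ≤-trans (≤-reflexive (≡.sym (𝟙-true (Q? v) Qx))) (m≤m+n _ _)
    ... | yes p | yes refl = contradiction p ¬Px
    ... | yes p | no _     with P⇒Q v p
    ...   | inj₁ q = ≤-trans (≤-reflexive (≡.sym (𝟙-true (Q? v) q))) (m≤m+n _ _)
    ...   | inj₂ e = ≤-trans (≤-reflexive (≡.sym (𝟙-true (v ≟ z) e))) (m≤n+m _ (𝟙 (Q? v)))

  private
    𝟙-mono : ∀ {v} → (P v → Q v) → 𝟙 (P? v) ≤ 𝟙 (Q? v)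
    𝟙-mono {v} P⇒Q with P? v
    ... | yes p = ≤-reflexive (≡.sym (𝟙-true (Q? v) (P⇒Q p)))
    ... | no _  = z≤n

  #-mono : (∀ v → P v → Q v) → # P? ≤ # Q?
  #-mono P⇒Q = ∑-mono (λ v → 𝟙-mono (P⇒Q v))

  #-mono-< : ∀ {x} → (∀ v → P v → Q v) → Q x → ¬ P x → # P? < # Q?
  #-mono-< {x} P⇒Q Qx ¬Px = ∑-mono-< _ _ x (λ v → 𝟙-mono (P⇒Q v))
    (≤-reflexive (≡.trans (cong suc (𝟙-false (P? x) ¬Px)) (≡.sym (𝟙-true (Q? x) Qx))))

  #-⊎ : {R : Fin n → Set} (R? : Decidable R) → (∀ v → P v → Q v ⊎ R v) → # P? ≤ # Q? + # R?
  #-⊎ R? P⇒Q⊎R = ≤-trans (∑-mono pointwise) (≤-reflexive (∑-+ _ _))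
    where
    pointwise : ∀ v → 𝟙 (P? v) ≤ 𝟙 (Q? v) + 𝟙 (R? v)
    pointwise v with P? v
    ... | no _  = z≤n
    ... | yes p with P⇒Q⊎R v p
    ...   | inj₁ q = ≤-trans (≤-reflexive (≡.sym (𝟙-true (Q? v) q))) (m≤m+n _ _)
    ...   | inj₂ r = ≤-trans (≤-reflexive (≡.sym (𝟙-true (R? v) r))) (m≤n+m _ (𝟙 (Q? v)))

  #-insert : ∀ {z} → (∀ v → P v → Q v ⊎ v ≡ z) → # P? ≤ suc (# Q?)
  #-insert {z} P⇒Q = ≤-trans (#-⊎ (_≟ z) P⇒Q)
    (≤-reflexive (≡.trans (cong (# Q? +_) (∑-point z)) (+-comm _ 1)))

module _ {n : ℕ} {P : Fin n → Set} (P? : Decidable P) where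

  #-positive : ∀ {v} → P v → 1 ≤ # P?
  #-positive {v} p = ≤-trans (≤-reflexive (≡.sym (𝟙-true (P? v) p))) (single≤∑ (λ v → 𝟙 (P? v)) v)

  #-witness : 1 ≤ # P? → ∃ P
  #-witness 1≤ with Fin.any? P?
  ... | yes ∃P = ∃P
  ... | no ¬∃P = contradiction 1≤ (<⇒≱ (s≤s (≤-reflexive (∑-zero (λ v → 𝟙-false (P? v) (λ p → ¬∃P (v , p)))))))

  #≤1 : (∀ {u v} → P u → P v → u ≡ v) → # P? ≤ 1
  #≤1 unique with Fin.any? P?
  ... | yes (v , p) = ≤-trans (#-mono P? (_≟ v) (λ u q → unique q p)) (≤-reflexive (∑-point v))
  ... | no ¬∃P      = ≤-trans (≤-reflexive (∑-zero (λ v → 𝟙-false (P? v) (λ p → ¬∃P (v , p))))) z≤n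

  #≥2 : ∀ {u v} → u ≢ v → P u → P v → 2 ≤ # P?
  #≥2 {u} {v} u≢v pu pv = ≤-trans (s≤s (≤-reflexive (≡.sym (∑-point u))))
    (#-mono-< (_≟ u) P? (λ { w refl → pu }) pv (u≢v ∘ ≡.sym))

  #-unique : # P? ≤ 1 → ∀ {u v} → P u → P v → u ≡ v
  #-unique #≤1 {u} {v} pu pv with u ≟ v
  ... | yes u≡v = u≡v
  ... | no  u≢v = contradiction (#≥2 u≢v pu pv) (<⇒≱ (s≤s #≤1))

  #≥2-witnesses : 2 ≤ # P? → ∃[ u ] ∃[ v ] (u ≢ v × P u × P v)
  #≥2-witnesses 2≤ with #-witness (≤-trans (n≤1+n 1) 2≤)
  ... | u , pu with Fin.any? (λ v → P? v ×-dec ¬? (u ≟ v))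
  ...   | yes (v , pv , u≢v) = u , v , u≢v , pu , pv
  ...   | no ¬other = contradiction 2≤ (<⇒≱ (s≤s (#≤1 (λ p q → ≡.trans (≡u p) (≡.sym (≡u q))))))
    where
    ≡u : ∀ {w} → P w → w ≡ u
    ≡u {w} pw with u ≟ w
    ... | yes u≡w = ≡.sym u≡w
    ... | no  u≢w = contradiction (w , pw , u≢w) ¬other

-- Vertex sets as Boolean predicates

infix 4 _∈_ _∉_ _∈?_
_∈_ : ∀ {n} → Fin n → VSet n → Set
v ∈ S = T (S v)

_∉_ : ∀ {n} → Fin n → VSet n → Set
v ∉ S = ¬ (v ∈ S)

_∈?_ : ∀ {n} (v : Fin n) (S : VSet n) → Dec (v ∈ S)
v ∈? S = T? (S v)

_∖_ : ∀ {n} → VSet n → VSet n → VSet n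
(S ∖ U) v = S v ∧ not (U v)

insert : ∀ {n} → Fin n → VSet n → VSet n
insert a S v = does (v ≟ a) ∨ S v

T-not⁺ : ∀ {b} → ¬ T b → T (not b)
T-not⁺ {true}  ¬t = ⊥-elim (¬t tt)
T-not⁺ {false} ¬t = tt

T-not⁻ : ∀ {b} → T (not b) → ¬ T b
T-not⁻ {false} _ ()

module _ {n : ℕ} {v : Fin n} (S U : VSet n) where

  ∈-∖⁺ : v ∈ S → v ∉ U → v ∈ S ∖ U
  ∈-∖⁺ v∈S v∉U = Equivalence.from T-∧ (v∈S , T-not⁺ v∉U)

  ∈-∖⁻ : v ∈ S ∖ U → v ∈ S × v ∉ U
  ∈-∖⁻ v∈ = let v∈S , v∉U = Equivalence.to T-∧ v∈ in v∈S , T-not⁻ v∉U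

module _ {n : ℕ} {a : Fin n} (S : VSet n) where

  ∈-insert⁺ : ∀ {v} → v ≡ a ⊎ v ∈ S → v ∈ insert a S
  ∈-insert⁺ {v} (inj₁ v≡a) rewrite dec-true (v ≟ a) v≡a = tt
  ∈-insert⁺ {v} (inj₂ v∈S) = Equivalence.from T-∨ (inj₂ v∈S)

  ∈-insert⁻ : ∀ {v} → v ∈ insert a S → v ≡ a ⊎ v ∈ S
  ∈-insert⁻ {v} v∈ with v ≟ a
  ... | yes v≡a = inj₁ v≡a
  ... | no  _   = inj₂ v∈

∣_∣ : ∀ {n} → VSet n → ℕ
∣ S ∣ = # (_∈? S)

count≡∣∣ : ∀ {n} (S : VSet n) → count S ≡ ∣ S ∣
count≡∣∣ S = ∑-unfold _

-- Matchings as involutions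

module Pairings {n : ℕ} (G : Graph n) where

  Adj : Fin n → Fin n → Set
  Adj u v = T (adj G u v)

  Adj-sym : ∀ {u v} → Adj u v → Adj v u
  Adj-sym {u} {v} = subst T (sym G u v)

  Adj-irrefl : ∀ {u v} → Adj u v → u ≢ v
  Adj-irrefl {u} uv refl = subst T (irrefl G u) uv

  -- A matching of G, encoded as an involution that fixes exactly the
  -- unmatched vertices.
  record Pairing : Set where
    field
      partner    : Fin n → Fin n
      involutive : ∀ v → partner (partner v) ≡ v
      edge       : ∀ {v} → partner v ≢ v → Adj v (partner v)
  open Pairing public

  Missed : Pairing → Fin n → Set
  Missed m v = partner m v ≡ v

  missed? : ∀ m → Decidable (Missed m)
  missed? m v = partner m v ≟ v

  Exposed : VSet n → Pairing → Fin n → Set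
  Exposed W m v = v ∈ W × Missed m v

  exposed? : ∀ W m → Decidable (Exposed W m)
  exposed? W m v = v ∈? W ×-dec missed? m v

  deficiency : VSet n → Pairing → ℕ
  deficiency W m = # (exposed? W m)

  Avoids : VSet n → Pairing → Set
  Avoids U m = ∀ {v} → v ∈ U → Missed m v

  disagree? : ∀ m m′ → Decidable (λ v → partner m v ≢ partner m′ v)
  disagree? m m′ v = ¬? (partner m v ≟ partner m′ v)

  -- The termination measure of the two arguments that move one matching towards another.
  disagreement : Pairing → Pairing → ℕ
  disagreement m m′ = # (disagree? m m′)

  partner-≢ : ∀ m {v} → ¬ Missed m v → ¬ Missed m (partner m v)
  partner-≢ m {v} v-matched e = v-matched (≡.trans (≡.sym e) (involutive m v))

  partner-swap : ∀ m {u v} → partner m u ≡ v → partner m v ≡ u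
  partner-swap m {u} e = ≡.trans (cong (partner m) (≡.sym e)) (involutive m u)

  -- The basic move: the edge xy enters the matching and the edge at y, if any, leaves it, so only
  -- the former partner of y can become newly missed. If y is missed as well, nothing leaves.
  module Exchange (m : Pairing) {x y : Fin n} (x-missed : Missed m x) (xy : Adj x y) where

    x≢y : x ≢ y
    x≢y = Adj-irrefl xy

    swap : Fin n → Fin n
    swap v with v ≟ x | v ≟ y | v ≟ partner m y
    ... | yes _ | _     | _     = y
    ... | no _  | yes _ | _     = x
    ... | no _  | no _  | yes _ = v
    ... | no _  | no _  | no _  = partner m v

    swap-x : swap x ≡ y
    swap-x with x ≟ x
    ... | yes _  = refl
    ... | no x≢x = contradiction refl x≢x

    swap-y : swap y ≡ x
    swap-y with y ≟ x | y ≟ y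
    ... | yes y≡x | _      = y≡x
    ... | no _    | yes _  = refl
    ... | no _    | no y≢y = contradiction refl y≢y

    swap-freed : ∀ {v} → v ≢ x → v ≢ y → v ≡ partner m y → swap v ≡ v
    swap-freed {v} v≢x v≢y e with v ≟ x | v ≟ y | v ≟ partner m y
    ... | yes v≡x | _       | _     = contradiction v≡x v≢x
    ... | no _    | yes v≡y | _     = contradiction v≡y v≢y
    ... | no _    | no _    | yes _ = refl
    ... | no _    | no _    | no ¬e = contradiction e ¬e

    swap-other : ∀ {v} → v ≢ x → v ≢ y → v ≢ partner m y → swap v ≡ partner m v
    swap-other {v} v≢x v≢y ¬e with v ≟ x | v ≟ y | v ≟ partner m y
    ... | yes v≡x | _       | _     = contradiction v≡x v≢x
    ... | no _    | yes v≡y | _     = contradiction v≡y v≢y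
    ... | no _    | no _    | yes e = contradiction e ¬e
    ... | no _    | no _    | no _  = refl

    swap-involutive : ∀ v → swap (swap v) ≡ v
    swap-involutive v = go (v ≟ x) (v ≟ y) (v ≟ partner m y)
      where
      go : Dec (v ≡ x) → Dec (v ≡ y) → Dec (v ≡ partner m y) → swap (swap v) ≡ v
      go (yes refl) _ _ = ≡.trans (cong swap swap-x) swap-y
      go (no _) (yes refl) _ = ≡.trans (cong swap swap-y) swap-x
      go (no v≢x) (no v≢y) (yes e) = ≡.trans (cong swap (swap-freed v≢x v≢y e)) (swap-freed v≢x v≢y e)
      -- The old partner of v falls into the last case again: it is not x, which is missed, and it
      -- is neither y nor the partner of y by the conditions on v.
      go (no v≢x) (no v≢y) (no ¬e) = ≡.trans (cong swap (swap-other v≢x v≢y ¬e))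
        (≡.trans (swap-other
          (λ e → v≢x (≡.trans (≡.sym (partner-swap m e)) x-missed))
          (λ e → ¬e (≡.sym (partner-swap m e)))
          (λ e → v≢y (≡.trans (≡.sym (involutive m v)) (≡.trans (cong (partner m) e) (involutive m y)))))
          (involutive m v))

    swap-edge : ∀ {v} → swap v ≢ v → Adj v (swap v)
    swap-edge {v} = go (v ≟ x) (v ≟ y) (v ≟ partner m y)
      where
      go : Dec (v ≡ x) → Dec (v ≡ y) → Dec (v ≡ partner m y) → swap v ≢ v → Adj v (swap v)
      go (yes refl) _ _ _ = subst (Adj v) (≡.sym swap-x) xy
      go (no _) (yes refl) _ _ = subst (Adj v) (≡.sym swap-y) (Adj-sym xy)
      go (no v≢x) (no v≢y) (yes e) moved = contradiction (swap-freed v≢x v≢y e) moved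
      go (no v≢x) (no v≢y) (no ¬e) moved =
        let same = swap-other v≢x v≢y ¬e in
        subst (Adj v) (≡.sym same) (edge m (λ e → moved (≡.trans same e)))

    exchange : Pairing
    exchange = record { partner = swap ; involutive = swap-involutive ; edge = swap-edge }

    covers-x : ¬ Missed exchange x
    covers-x e = x≢y (≡.trans (≡.sym e) swap-x)

    covers-y : ¬ Missed exchange y
    covers-y e = x≢y (≡.trans (≡.sym swap-y) e)

    still-missed : ∀ {v} → v ≢ x → v ≢ y → Missed m v → Missed exchange v
    still-missed {v} v≢x v≢y missed = case v ≟ partner m y of λ where
      (yes e) → swap-freed v≢x v≢y e
      (no ¬e) → ≡.trans (swap-other v≢x v≢y ¬e) missed

    missed⁻ : ∀ {v} → Missed exchange v → Missed m v ⊎ v ≡ partner m y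
    missed⁻ {v} missed with v ≟ x | v ≟ y | v ≟ partner m y
    ... | yes refl | _        | _     = inj₁ x-missed
    ... | no _     | yes refl | _     = contradiction missed x≢y
    ... | no _     | no _     | yes e = inj₂ e
    ... | no _     | no _     | no _  = inj₁ missed

    exchange-avoids : ∀ {U} → Avoids U m → x ∉ U → y ∉ U → Avoids U exchange
    exchange-avoids {U} avoids x∉U y∉U v∈U = still-missed
      (λ { refl → x∉U v∈U }) (λ { refl → y∉U v∈U }) (avoids v∈U)

    module _ {W : VSet n} (x∈W : x ∈ W) where

      -- The gain of x pays for the possible loss of the former partner of y.
      deficiency-≤ : deficiency W exchange ≤ deficiency W m
      deficiency-≤ = #-exchange (exposed? W exchange) (exposed? W m)
        (λ v (v∈W , missed) → [ (λ missed′ → inj₁ (v∈W , missed′)) , inj₂ ]′ (missed⁻ missed))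
        (x∈W , x-missed) (covers-x ∘ proj₂)

      -- Here the vertex that could be freed is y itself, which is now covered.
      deficiency-< : Missed m y → deficiency W exchange < deficiency W m
      deficiency-< y-missed = #-mono-< (exposed? W exchange) (exposed? W m)
        (λ v (v∈W , missed) → v∈W ,
          [ id , (λ e → contradiction (subst (Missed exchange) (≡.trans e y-missed) missed) covers-y) ]′ (missed⁻ missed))
        (x∈W , x-missed) (covers-x ∘ proj₂)

    -- The row of x is corrected, and no agreement is lost: the edge dropped at y was not in `m′`,
    -- which matches y with x.
    closer : ∀ m′ → partner m′ x ≡ y → disagreement exchange m′ < disagreement m m′
    closer m′ e = #-mono-< (disagree? exchange m′) (disagree? m m′) (λ v → _∘ agree v) (λ e′ → x≢y (≡.trans (≡.sym x-missed) (≡.trans e′ e)))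
      (λ ¬e → ¬e (≡.trans swap-x (≡.sym e)))
      where
      agree : ∀ v → partner m v ≡ partner m′ v → swap v ≡ partner m′ v
      agree v same with v ≟ x | v ≟ y | v ≟ partner m y
      ... | yes refl | _        | _       = ≡.sym e
      ... | no _     | yes refl | _       = ≡.sym (partner-swap m′ e)
      ... | no v≢x   | no _     | yes v≡  = contradiction
        (≡.trans (≡.sym (partner-swap m′ (≡.trans (≡.sym same) (partner-swap m (≡.sym v≡))))) (partner-swap m′ e)) v≢x
      ... | no _     | no _     | no _    = same

  open Exchange public using (exchange; exchange-avoids; deficiency-≤; deficiency-<; closer)

  -- Makes a matching avoid one further vertex, as required when `U` grows.
  unmatch : Pairing → Fin n → Pairing
  unmatch m a = record { partner = partner′ ; involutive = involutive′ ; edge = edge′ }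
    where
    partner′ : Fin n → Fin n
    partner′ v with v ≟ a | v ≟ partner m a
    ... | no _  | no _ = partner m v
    ... | _     | _    = v

    other : ∀ {v} → v ≢ a → v ≢ partner m a → partner′ v ≡ partner m v
    other {v} v≢a v≢a′ with v ≟ a | v ≟ partner m a
    ... | yes e | _     = contradiction e v≢a
    ... | no _  | yes e = contradiction e v≢a′
    ... | no _  | no _  = refl

    involutive′ : ∀ v → partner′ (partner′ v) ≡ v
    involutive′ v with v ≟ a in eq | v ≟ partner m a in eq′
    ... | yes _ | yes _ rewrite eq = refl
    ... | yes _ | no _  rewrite eq = refl
    ... | no _  | yes _ rewrite eq | eq′ = refl
    ... | no v≢a | no v≢a′ = ≡.trans
      (other (λ e → v≢a′ (≡.sym (partner-swap m e)))
             (λ e → v≢a (≡.trans (≡.sym (involutive m v)) (≡.trans (cong (partner m) e) (involutive m a)))))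
      (involutive m v)

    edge′ : ∀ {v} → partner′ v ≢ v → Adj v (partner′ v)
    edge′ {v} moved with v ≟ a | v ≟ partner m a
    ... | yes _ | yes _ = contradiction refl moved
    ... | yes _ | no _  = contradiction refl moved
    ... | no _  | yes _ = contradiction refl moved
    ... | no _  | no _  = edge m moved

  unmatch-self : ∀ m a → Missed (unmatch m a) a
  unmatch-self m a with a ≟ a | a ≟ partner m a
  ... | yes _ | yes _ = refl
  ... | yes _ | no _  = refl
  ... | no ¬e | _     = contradiction refl ¬e

  unmatch-missed⁺ : ∀ m a {v} → Missed m v → Missed (unmatch m a) v
  unmatch-missed⁺ m a {v} missed with v ≟ a | v ≟ partner m a
  ... | yes _ | yes _ = refl
  ... | yes _ | no _  = refl
  ... | no _  | yes _ = refl
  ... | no _  | no _  = missed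

  unmatch-missed⁻ : ∀ m a {v} → v ≢ a → Missed (unmatch m a) v → Missed m v ⊎ v ≡ partner m a
  unmatch-missed⁻ m a {v} v≢a missed with v ≟ a | v ≟ partner m a
  ... | yes e | _     = contradiction e v≢a
  ... | no _  | yes e = inj₂ e
  ... | no _  | no _  = inj₁ missed

-- Gallai–Edmonds classes

module Critical {n : ℕ} (G : Graph n) (C U : VSet n) (K : ℕ)
  (lower : ∀ m → Pairings.Avoids G U m → K ≤ Pairings.deficiency G (C ∖ U) m)
  where

  open Pairings G

  W : VSet n
  W = C ∖ U

  -- Together with `lower` the inequality says that the deficiency is exactly `K`.
  Optimal : Pairing → Set
  Optimal m = Avoids U m × deficiency W m ≤ K

  -- The diagonal case `Coexposed v v` expresses that some optimal matching misses v.
  Coexposed : Fin n → Fin n → Set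
  Coexposed u v = ∃[ m ] (Optimal m × Missed m u × Missed m v)

  W⇒∉U : ∀ {v} → v ∈ W → v ∉ U
  W⇒∉U = proj₂ ∘ ∈-∖⁻ C U

  -- Otherwise adding the edge xy would still avoid `U` and bring the deficiency below `K`.
  missed-ends : ∀ m → Optimal m → ∀ {x y} → x ∈ W → y ∉ U → Adj x y → Missed m x → ¬ Missed m y
  missed-ends m (avoids , m≤K) x∈W y∉U xy x-missed y-missed =
    <⇒≱ (<-≤-trans (deficiency-< m x-missed xy x∈W y-missed) m≤K)
        (lower (exchange m x-missed xy) (exchange-avoids m x-missed xy avoids (W⇒∉U x∈W) y∉U))

  matched-∉U : ∀ m → Avoids U m → ∀ {v} → ¬ Missed m v → v ∉ U
  matched-∉U m avoids v-matched v∈U = v-matched (avoids v∈U)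

  -- Hence "equal or not coexposed" is an equivalence relation on the vertices of
  -- W missed by optimal matchings.  The matching missing v is moved towards M.
  coexposed-split : ∀ {u v w} → Coexposed u w → u ≢ w → u ∈ W → w ∈ W → Coexposed v v →
                    Coexposed v u ⊎ Coexposed v w
  coexposed-split {u} {v} {w} (M , optM , Mu , Mw) u≢w u∈W w∈W (N₀ , optN₀ , N₀v , _) =
    go (suc (disagreement N₀ M)) N₀ optN₀ N₀v ≤-refl
    where
    go : ∀ fuel N → Optimal N → Missed N v → disagreement N M < fuel → Coexposed v u ⊎ Coexposed v w
    go zero    N optN Nv ()
    go (suc fuel) N optN@(N-avoids , N≤K) Nv (s≤s N<fuel) with missed? N u | missed? N w
    ... | yes Nu | _      = inj₁ (N , optN , Nv , Nu)
    ... | no _   | yes Nw = inj₂ (N , optN , Nv , Nw)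
    ... | no ¬Nu | no ¬Nw with Fin.any? (λ x → exposed? W N x ×-dec (¬? (missed? M x) ×-dec ¬? (x ≟ v)))
    -- The M-edge at x is forced into N. Neither of its ends is v, since N cannot miss both ends of
    -- an edge at x, so v stays missed.
    ...   | yes (x , (x∈W , Nx) , x-matched , x≢v) = go fuel N′ optN′ N′v
              (<-≤-trans (closer N Nx xy M refl) N<fuel)
      where
      y = partner M x
      xy = edge M x-matched
      y∉U : y ∉ U
      y∉U = matched-∉U M (proj₁ optM) (partner-≢ M x-matched)
      N′ = exchange N Nx xy
      optN′ : Optimal N′
      optN′ = exchange-avoids N Nx xy N-avoids (W⇒∉U x∈W) y∉U , ≤-trans (deficiency-≤ N Nx xy x∈W) N≤K
      v≢y : v ≢ y
      v≢y refl = missed-ends N optN x∈W y∉U xy Nx Nv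
      N′v : Missed N′ v
      N′v = Exchange.still-missed N Nx xy (x≢v ∘ ≡.sym) v≢y Nv
    -- Apart from v, N exposes only vertices that M exposes, and M also exposes u and w, which N
    -- matches. Here w pays for v and u makes the inequality strict, so N beats the minimum `K`.
    ...   | no none = contradiction (lower N N-avoids) (<⇒≱ (<-≤-trans N<M (proj₂ optM)))
      where
      M-not-u? : Decidable (λ x → Exposed W M x × x ≢ u)
      M-not-u? x = exposed? W M x ×-dec ¬? (x ≟ u)
      N⇒M : ∀ x → Exposed W N x → (Exposed W M x × x ≢ u) ⊎ x ≡ v
      N⇒M x (x∈W , Nx) with missed? M x | x ≟ v
      ... | _      | yes x≡v = inj₂ x≡v
      ... | yes Mx | no _    = inj₁ ((x∈W , Mx) , λ { refl → ¬Nu Nx })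
      ... | no ¬Mx | no x≢v  = contradiction (x , (x∈W , Nx) , ¬Mx , x≢v) none
      N<M : deficiency W N < deficiency W M
      N<M = ≤-<-trans
        (#-exchange (exposed? W N) M-not-u? N⇒M ((w∈W , Mw) , u≢w ∘ ≡.sym) (¬Nw ∘ proj₂))
        (#-mono-< M-not-u? (exposed? W M) (λ _ → proj₁) (u∈W , Mu) (λ (_ , u≢u) → u≢u refl))

  InD : Fin n → Set
  InD v = v ∈ W × Coexposed v v

  -- The matching missing a is moved towards N by exchanges.
  neighbour-InD : ∀ {x a} → InD x → Adj x a → a ∉ U →
                  ∀ M → Avoids (insert a U) M → deficiency (C ∖ insert a U) M ≤ K → InD a
  neighbour-InD {x} {a} (x∈W , N , optN , Nx , _) xa a∉U M₀ M₀-avoids M₀≤K =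
    go (suc (disagreement M₀ N)) M₀ M₀-avoids M₀≤K ≤-refl
    where
    W′ : VSet n
    W′ = C ∖ insert a U

    W′⇒W : ∀ {v} → v ∈ W′ → v ∈ W
    W′⇒W v∈W′ = let v∈C , v∉ = ∈-∖⁻ C (insert a U) v∈W′ in ∈-∖⁺ C U v∈C (v∉ ∘ ∈-insert⁺ U ∘ inj₂)

    W⇒W′ : ∀ {v} → v ≢ a → v ∈ W → v ∈ W′
    W⇒W′ v≢a v∈W = let v∈C , v∉U = ∈-∖⁻ C U v∈W in
      ∈-∖⁺ C (insert a U) v∈C ([ v≢a , v∉U ]′ ∘ ∈-insert⁻ U)

    x∈W′ : x ∈ W′
    x∈W′ = W⇒W′ (Adj-irrefl xa) x∈W

    -- Adding the edge wa would cover a, the only vertex by which `W` can exceed `W′`, and also w,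
    -- so the deficiency on `W` would drop below `K`.
    no-missed-neighbour : ∀ M → Avoids (insert a U) M → deficiency W′ M ≤ K →
                          ∀ {w} → w ∈ W′ → Adj w a → ¬ Missed M w
    no-missed-neighbour M avoids M≤K {w} w∈W′ wa Mw =
      <⇒≱ (<-≤-trans fewer M≤K) (lower M′ (exchange-avoids M Mw wa (avoids ∘ ∈-insert⁺ U ∘ inj₂) (W⇒∉U (W′⇒W w∈W′)) a∉U))
      where
      M′ = exchange M Mw wa
      Ma : Missed M a
      Ma = avoids (∈-insert⁺ U (inj₁ refl))
      fewer : deficiency W M′ < deficiency W′ M
      fewer = ≤-<-trans
        (#-mono (exposed? W M′) (exposed? W′ M′) λ v (v∈W , M′v) →
          W⇒W′ (λ { refl → Exchange.covers-y M Mw wa M′v }) v∈W , M′v)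
        (deficiency-< M Mw wa w∈W′ Ma)

    go : ∀ fuel M → Avoids (insert a U) M → deficiency W′ M ≤ K → disagreement M N < fuel → InD a
    go zero    M avoids M≤K ()
    go (suc fuel) M avoids M≤K (s≤s M<fuel) with Fin.any? (λ w → exposed? W′ M w ×-dec ¬? (missed? N w))
    ... | yes (w , (w∈W′ , Mw) , w-matched) = go fuel M′
            (exchange-avoids M Mw wy avoids (proj₂ (∈-∖⁻ C (insert a U) w∈W′)) y∉)
            (≤-trans (deficiency-≤ M Mw wy w∈W′) M≤K)
            (<-≤-trans (closer M Mw wy N refl) M<fuel)
      where
      y = partner N w
      wy = edge N w-matched
      M′ = exchange M Mw wy
      y∉ : y ∉ insert a U
      y∉ y∈ with ∈-insert⁻ U y∈
      ... | inj₁ y≡a = no-missed-neighbour M avoids M≤K w∈W′ (subst (Adj w) y≡a wy) Mw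
      ... | inj₂ y∈U = matched-∉U N (proj₁ optN) (partner-≢ N w-matched) y∈U
    -- Now N misses all that M exposes in `W′`, and also x, which M matches as a neighbour of a. So
    -- M exposes fewer than `K` vertices of `W′`; counting a as well, M is optimal for `U`. Were a
    -- outside `W`, M would even beat `K`.
    ... | no none = a∈W , M , (U-avoids , M-total≤K) , Ma , Ma
      where
      Ma : Missed M a
      Ma = avoids (∈-insert⁺ U (inj₁ refl))
      U-avoids : Avoids U M
      U-avoids = avoids ∘ ∈-insert⁺ U ∘ inj₂
      M<K : deficiency W′ M < K
      M<K = <-≤-trans (#-mono-< (exposed? W′ M) (exposed? W N) M⇒N (x∈W , Nx)
              (λ (_ , Mx) → no-missed-neighbour M avoids M≤K x∈W′ xa Mx)) (proj₂ optN)
        where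
        M⇒N : ∀ v → Exposed W′ M v → Exposed W N v
        M⇒N v (v∈W′ , Mv) with missed? N v
        ... | yes Nv = W′⇒W v∈W′ , Nv
        ... | no ¬Nv = contradiction (v , (v∈W′ , Mv) , ¬Nv) none
      M-total≤K : deficiency W M ≤ K
      M-total≤K = ≤-trans (#-insert (exposed? W M) (exposed? W′ M) split) M<K
        where
        split : ∀ v → Exposed W M v → Exposed W′ M v ⊎ v ≡ a
        split v (v∈W , Mv) = case v ≟ a of λ where
          (yes v≡a) → inj₂ v≡a
          (no  v≢a) → inj₁ (W⇒W′ v≢a v∈W , Mv)
      a∈W : a ∈ W
      a∈W with a ∈? W
      ... | yes a∈ = a∈
      ... | no  a∉ = contradiction (lower M U-avoids) (<⇒≱ (≤-<-trans
        (#-mono (exposed? W M) (exposed? W′ M) λ v (v∈W , Mv) → W⇒W′ (λ { refl → a∉ v∈W }) v∈W , Mv) M<K))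

  -- The second hypothesis says that U is maximal: moving a further vertex a into
  -- U does not increase the deficiency.
  module Classes
    (coexposed? : ∀ u v → Dec (Coexposed u v))
    (inessential : ∀ a → a ∉ U → ¬ ¬ (∃[ M ] (Avoids (insert a U) M × deficiency (C ∖ insert a U) M ≤ K)))
    where

    inD? : Decidable InD
    inD? v = v ∈? W ×-dec coexposed? v v

    -- Maximality of `U` supplies its matching only under double negation, which decidability of
    -- `InD` removes.
    closed : ∀ {x a} → InD x → Adj x a → a ∉ U → InD a
    closed {a = a} x∈D xa a∉U = decidable-stable (inD? a)
      (¬¬-map (λ (M , avoids , M≤K) → neighbour-InD x∈D xa a∉U M avoids M≤K) (inessential a a∉U))

    -- The class of u in D. Equality is a separate alternative because a vertex of D is coexposed
    -- with itself.
    Class : Fin n → Fin n → Set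
    Class u d = InD d × (d ≡ u ⊎ ¬ Coexposed d u)

    class? : ∀ u → Decidable (Class u)
    class? u d = inD? d ×-dec (d ≟ u ⊎-dec ¬? (coexposed? d u))

    ¬adjacent-coexposed : ∀ {u v} → u ∈ W → v ∉ U → Adj u v → ¬ Coexposed u v
    ¬adjacent-coexposed u∈W v∉U uv (m , optm , mu , mv) = missed-ends m optm u∈W v∉U uv mu mv

    -- If w were coexposed with u, then by `coexposed-split` q would be coexposed with its neighbour
    -- w or with its classmate u. For q = u, adjacency alone is the contradiction.
    class-closed : ∀ {u q w} → u ∈ W → Class u q → Adj q w → w ∉ U → Class u w
    class-closed {u} {q} {w} u∈W (q∈D@(q∈W , co-q) , q~u) qw w∉U = w∈D , w~u (w ≟ u)
      where
      w∈D : InD w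
      w∈D = closed q∈D qw w∉U
      w~u : Dec (w ≡ u) → w ≡ u ⊎ ¬ Coexposed w u
      w~u (yes w≡u) = inj₁ w≡u
      w~u (no w≢u) = inj₂ λ co → [ (λ { refl → ¬adjacent-coexposed (proj₁ w∈D) (W⇒∉U q∈W) (Adj-sym qw) co })
                                 , (λ ¬co-qu → [ ¬adjacent-coexposed q∈W w∉U qw , ¬co-qu ]′
                                     (coexposed-split co w≢u (proj₁ w∈D) u∈W co-q)) ]′ q~u

    -- Distinct vertices missed by the same M are coexposed, so by `coexposed-split` no d is
    -- equivalent to both.
    class-unique : ∀ M → Optimal M → ∀ {u u′ d} → Exposed W M u → Exposed W M u′ →
                   Class u d → Class u′ d → u ≡ u′
    class-unique M optM {u} {u′} {d} (u∈W , Mu) (u′∈W , Mu′) ((_ , co-d) , d~u) (_ , d~u′) with u ≟ u′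
    ... | yes u≡u′ = u≡u′
    ... | no  u≢u′ with d~u | d~u′
    ...   | inj₁ refl | inj₁ d≡u′ = d≡u′
    ...   | inj₁ refl | inj₂ ¬co  = contradiction (M , optM , Mu , Mu′) ¬co
    ...   | inj₂ ¬co  | inj₁ refl = contradiction (M , optM , Mu′ , Mu) ¬co
    ...   | inj₂ ¬co  | inj₂ ¬co′ =
      ⊥-elim ([ ¬co , ¬co′ ]′ (coexposed-split (M , optM , Mu , Mu′) u≢u′ u∈W u′∈W co-d))

    module Cover
      (F : Fin n → Fin n → Bool)
      (F-sym : ∀ {u v} → T (F u v) → T (F v u))
      (F⇒Adj : ∀ {u v} → T (F u v) → Adj u v)
      (F-covers : ∀ {v} → InD v → ∃[ w ] T (F v w))
      where

      nbr? : ∀ v → Decidable (λ w → T (F v w))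
      nbr? v w = T? (F v w)

      out? : ∀ v → Decidable (λ w → T (F v w) × w ∈ U)
      out? v w = T? (F v w) ×-dec w ∈? U

      -- An F-edge into `U` counts twice at its end in D; the second count is charged to its end in
      -- `U`.
      load : Fin n → ℕ
      load v = # (nbr? v) + # (out? v)

      load-positive : ∀ {v} → InD v → 1 ≤ load v
      load-positive {v} v∈D = ≤-trans (#-positive (nbr? v) (proj₂ (F-covers v∈D))) (m≤m+n _ _)

      -- Otherwise F is a perfect matching of the class of u, and replacing M by
      -- F on this class would expose fewer vertices.
      overloaded : ∀ M → Optimal M → ∀ {u} → Exposed W M u → ∃[ d ] (Class u d × 2 ≤ load d)
      overloaded M optM@(M-avoids , M≤K) {u} (u∈W , Mu) with Fin.any? (λ d → class? u d ×-dec 2 ≤? load d)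
      ... | yes found = found
      ... | no none = contradiction (lower M′ M′-avoids) (<⇒≱ (<-≤-trans fewer M≤K))
        where
        light : ∀ {d} → Class u d → load d ≤ 1
        light {d} cd with 2 ≤? load d
        ... | yes 2≤ = contradiction (d , cd , 2≤) none
        ... | no  2≰ = ≤-pred (≰⇒> 2≰)

        u∈class : Class u u
        u∈class = (u∈W , M , optM , Mu , Mu) , inj₁ refl

        pick : Fin n → Fin n
        pick v with Fin.any? (nbr? v)
        ... | yes (w , _) = w
        -- A default value, never met on a class, whose vertices F covers.
        ... | no _        = v

        pick-F : ∀ {v} → Class u v → T (F v (pick v))
        pick-F {v} (v∈D , _) with Fin.any? (nbr? v)
        ... | yes (w , vw) = vw
        ... | no none′     = contradiction (F-covers v∈D) none′

        -- A single F-edge into `U` already gives load 2.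
        pick∉U : ∀ {v} → Class u v → pick v ∉ U
        pick∉U {v} cv pv∈U = <⇒≱ (s≤s (light cv))
          (+-mono-≤ (#-positive (nbr? v) (pick-F cv)) (#-positive (out? v) (pick-F cv , pv∈U)))

        pick-class : ∀ {v} → Class u v → Class u (pick v)
        pick-class cv = class-closed u∈W cv (F⇒Adj (pick-F cv)) (pick∉U cv)

        -- With load at most 1, `pick v` has a single F-neighbour, and v is one.
        pick-pick : ∀ {v} → Class u v → pick (pick v) ≡ v
        pick-pick {v} cv = #-unique (nbr? (pick v)) (≤-trans (m≤m+n _ _) (light (pick-class cv)))
          (pick-F (pick-class cv)) (F-sym (pick-F cv))

        -- M-edges lie outside `U`, so `class-closed` along such an edge would pull v into the
        -- class. Hence M preserves the complement of the class and can be glued to F there.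
        partner-class : ∀ {v} → ¬ Class u v → ¬ Class u (partner M v)
        partner-class {v} ¬cv c with missed? M v
        ... | yes Mv = ¬cv (subst (Class u) Mv c)
        ... | no ¬Mv = ¬cv (class-closed u∈W c (Adj-sym (edge M ¬Mv)) (matched-∉U M M-avoids ¬Mv))

        partner′ : Fin n → Fin n
        partner′ v with class? u v
        ... | yes _ = pick v
        ... | no _  = partner M v

        inside : ∀ {v} → Class u v → partner′ v ≡ pick v
        inside {v} cv with class? u v
        ... | yes _  = refl
        ... | no ¬cv = contradiction cv ¬cv

        outside : ∀ {v} → ¬ Class u v → partner′ v ≡ partner M v
        outside {v} ¬cv with class? u v
        ... | yes cv = contradiction cv ¬cv
        ... | no _   = refl

        M′ : Pairing
        M′ = record
          { partner    = partner′
          ; involutive = λ v → case class? u v of λ where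
              (yes cv) → ≡.trans (cong partner′ (inside cv)) (≡.trans (inside (pick-class cv)) (pick-pick cv))
              (no ¬cv) → ≡.trans (cong partner′ (outside ¬cv)) (≡.trans (outside (partner-class ¬cv)) (involutive M v))
          ; edge       = λ {v} moved → case class? u v of λ where
              (yes cv) → subst (Adj v) (≡.sym (inside cv)) (F⇒Adj (pick-F cv))
              (no ¬cv) → subst (Adj v) (≡.sym (outside ¬cv)) (edge M (λ Mv → moved (≡.trans (outside ¬cv) Mv)))
          }

        class-matched : ∀ {v} → Class u v → ¬ Missed M′ v
        class-matched {v} cv M′v = Adj-irrefl (F⇒Adj (pick-F cv)) (≡.trans (≡.sym M′v) (inside cv))

        M′-avoids : Avoids U M′
        M′-avoids v∈U = ≡.trans (outside (λ ((v∈W , _) , _) → W⇒∉U v∈W v∈U)) (M-avoids v∈U)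

        fewer : deficiency W M′ < deficiency W M
        fewer = #-mono-< (exposed? W M′) (exposed? W M)
          (λ v (v∈W , M′v) → v∈W , ≡.trans (≡.sym (outside (λ cv → class-matched cv M′v))) M′v)
          (u∈W , Mu) (class-matched u∈class ∘ proj₂)

      -- The second count of an F-edge from D to `U` is transferred to the degree of its end in `U`.
      -- Since D and `U` are disjoint, no degree is used twice.
      ∑-load : ∑ (λ d → 𝟙 (inD? d) * load d) ≤ ∑ (λ v → # (nbr? v))
      ∑-load = begin
        ∑ (λ d → 𝟙 (inD? d) * load d)
          ≡⟨ ∑-cong (λ d → *-distribˡ-+ (𝟙 (inD? d)) _ _) ⟩
        ∑ (λ d → 𝟙 (inD? d) * # (nbr? d) + 𝟙 (inD? d) * # (out? d))
          ≡⟨ ∑-+ _ _ ⟩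
        ∑ (λ d → 𝟙 (inD? d) * # (nbr? d)) + ∑ (λ d → 𝟙 (inD? d) * # (out? d))
          ≤⟨ +-monoʳ-≤ _ (∑-mono out-as-pairs) ⟩
        ∑ (λ d → 𝟙 (inD? d) * # (nbr? d)) + ∑ (λ d → # (pair? d))
          ≡⟨ cong (∑ (λ d → 𝟙 (inD? d) * # (nbr? d)) +_) (∑-comm _) ⟩
        ∑ (λ d → 𝟙 (inD? d) * # (nbr? d)) + ∑ (λ t → # (λ d → pair? d t))
          ≤⟨ +-monoʳ-≤ _ (∑-mono pairs-in) ⟩
        ∑ (λ d → 𝟙 (inD? d) * # (nbr? d)) + ∑ (λ t → 𝟙 (t ∈? U) * # (nbr? t))
          ≡⟨ ∑-+ _ _ ⟨
        ∑ (λ v → 𝟙 (inD? v) * # (nbr? v) + 𝟙 (v ∈? U) * # (nbr? v))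
          ≤⟨ ∑-mono disjoint ⟩
        ∑ (λ v → # (nbr? v)) ∎
        where
        open ≤-Reasoning
        pair? : ∀ d → Decidable (λ t → InD d × T (F d t) × t ∈ U)
        pair? d t = inD? d ×-dec out? d t
        out-as-pairs : ∀ d → 𝟙 (inD? d) * # (out? d) ≤ # (pair? d)
        out-as-pairs d = 𝟙-cases (λ b → b * # (out? d) ≤ # (pair? d)) (inD? d)
          (λ d∈D → ≤-trans (≤-reflexive (*-identityˡ _)) (#-mono (out? d) (pair? d) λ t o → d∈D , o))
          (λ _ → z≤n)
        pairs-in : ∀ t → # (λ d → pair? d t) ≤ 𝟙 (t ∈? U) * # (nbr? t)
        pairs-in t = 𝟙-cases (λ b → # (λ d → pair? d t) ≤ b * # (nbr? t)) (t ∈? U)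
          (λ _ → ≤-trans (#-mono (λ d → pair? d t) (nbr? t) λ d (_ , dt , _) → F-sym dt) (≤-reflexive (≡.sym (*-identityˡ _))))
          (λ t∉U → ≤-reflexive (∑-zero λ d → 𝟙-false (pair? d t) (t∉U ∘ proj₂ ∘ proj₂)))
        disjoint : ∀ v → 𝟙 (inD? v) * # (nbr? v) + 𝟙 (v ∈? U) * # (nbr? v) ≤ # (nbr? v)
        disjoint v = ≤-trans (≤-reflexive (≡.sym (*-distribʳ-+ (# (nbr? v)) (𝟙 (inD? v)) _)))
          (≤-trans (*-monoˡ-≤ (# (nbr? v)) at-most-one) (≤-reflexive (*-identityˡ _)))
          where
          at-most-one : 𝟙 (inD? v) + 𝟙 (v ∈? U) ≤ 1
          at-most-one = 𝟙-cases (λ b → b + 𝟙 (v ∈? U) ≤ 1) (inD? v)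
            (λ (v∈W , _) → ≤-reflexive (cong suc (𝟙-false (v ∈? U) (W⇒∉U v∈W))))
            (λ _ → 𝟙≤1 (v ∈? U))

      -- Every vertex of D has load at least 1. M exposes at least `K` vertices, each with a vertex
      -- of load at least 2 in its class, and by `class-unique` these are distinct.
      degree-sum : ∀ M → Optimal M → # inD? + K ≤ ∑ (λ v → # (nbr? v))
      degree-sum M optM = begin
        # inD? + K                                           ≤⟨ +-monoʳ-≤ (# inD?) (lower M (proj₁ optM)) ⟩
        # inD? + deficiency W M                              ≤⟨ +-monoʳ-≤ (# inD?) (∑-mono exposed≤heavy) ⟩
        # inD? + ∑ (λ u → # (heavy? u))                      ≡⟨ cong (# inD? +_) (∑-comm _) ⟩
        # inD? + ∑ (λ d → # (λ u → heavy? u d))              ≡⟨ ∑-+ _ _ ⟨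
        ∑ (λ d → 𝟙 (inD? d) + # (λ u → heavy? u d))          ≤⟨ ∑-mono heavy≤load ⟩
        ∑ (λ d → 𝟙 (inD? d) * load d)                        ≤⟨ ∑-load ⟩
        ∑ (λ v → # (nbr? v))                                 ∎
        where
        open ≤-Reasoning
        heavy? : ∀ u → Decidable (λ d → Exposed W M u × Class u d × 2 ≤ load d)
        heavy? u d = exposed? W M u ×-dec (class? u d ×-dec 2 ≤? load d)

        exposed≤heavy : ∀ u → 𝟙 (exposed? W M u) ≤ # (heavy? u)
        exposed≤heavy u = 𝟙-cases (_≤ # (heavy? u)) (exposed? W M u)
          (λ e → #-positive (heavy? u) (e , proj₂ (overloaded M optM e)))
          (λ _ → z≤n)

        heavy≤load : ∀ d → 𝟙 (inD? d) + # (λ u → heavy? u d) ≤ 𝟙 (inD? d) * load d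
        heavy≤load d = 𝟙-cases (λ b → b + # (λ u → heavy? u d) ≤ b * load d) (inD? d)
          (λ d∈D → ≤-trans (at-most-load d∈D) (≤-reflexive (≡.sym (*-identityˡ _))))
          (λ d∉D → ≤-reflexive (∑-zero λ u → 𝟙-false (heavy? u d) λ (_ , (d∈D , _) , _) → d∉D d∈D))
          where
          at-most-load : InD d → 1 + # (λ u → heavy? u d) ≤ load d
          at-most-load d∈D with Fin.any? (λ u → heavy? u d)
          ... | yes (u , _ , _ , 2≤) = ≤-trans (s≤s (#≤1 (λ u → heavy? u d)
                  λ (e , c , _) (e′ , c′ , _) → class-unique M optM e e′ c c′)) 2≤
          ... | no none = ≤-trans (s≤s (≤-reflexive (∑-zero λ u → 𝟙-false (heavy? u d) λ h → none (u , h)))) (load-positive d∈D)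

-- Degrees, maximum degree and closed neighbourhoods

T⇒≡ : ∀ {b} → T b → b ≡ true
T⇒≡ = Equivalence.to T-≡

≡⇒T : ∀ {b} → b ≡ true → T b
≡⇒T = Equivalence.from T-≡

T-injective : ∀ {a b} → (T a → T b) → (T b → T a) → a ≡ b
T-injective {true}  {true}  _ _ = refl
T-injective {true}  {false} f _ = ⊥-elim (f tt)
T-injective {false} {true}  _ g = ⊥-elim (g tt)
T-injective {false} {false} _ _ = refl

module _ {n : ℕ} (A : Fin n → Fin n → Bool) where

  degree-≤-Δ : ∀ v → degA A v ≤ ΔA A
  degree-≤-Δ v = bound (∈-allFin v)
    where
    bound : ∀ {xs} → v ∈ᴸ xs → degA A v ≤ foldr _⊔_ 0 (map (degA A) xs)
    bound (here refl)  = m≤m⊔n _ _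
    bound (there v∈xs) = ≤-trans (bound v∈xs) (m≤n⊔m _ _)

  Δ-lub : ∀ {k} → (∀ v → degA A v ≤ k) → ΔA A ≤ k
  Δ-lub {k} degree≤k = bound (allFin n)
    where
    bound : ∀ xs → foldr _⊔_ 0 (map (degA A) xs) ≤ k
    bound []       = z≤n
    bound (x ∷ xs) = ⊔-lub (degree≤k x) (bound xs)

  degree≡∣∣ : ∀ v → degA A v ≡ ∣ A v ∣
  degree≡∣∣ v = count≡∣∣ (A v)

degA-cong : ∀ {n} {A B : Fin n → Fin n → Bool} → (∀ i j → A i j ≡ B i j) → ∀ v → degA A v ≡ degA B v
degA-cong {n} A≗B v = cong sum (map-cong (λ u → cong (λ b → if b then 1 else 0) (A≗B v u)) (allFin n))

ΔA-cong : ∀ {n} {A B : Fin n → Fin n → Bool} → (∀ i j → A i j ≡ B i j) → ΔA A ≡ ΔA B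
ΔA-cong {n} A≗B = cong (foldr _⊔_ 0) (map-cong (degA-cong A≗B) (allFin n))

module _ {n : ℕ} (S : VSet n) where

  ∈-closedNbhd⁻ : ∀ {G : Graph n} {v} → v ∈ closedNbhd G S → v ∈ S ⊎ ∃[ u ] (u ∈ S × T (adj G u v))
  ∈-closedNbhd⁻ {G} {v} v∈ with Equivalence.to T-∨ v∈
  ... | inj₁ v∈S = inj₁ v∈S
  ... | inj₂ any = inj₂ (find (allFin n) any)
    where
    find : ∀ xs → T (foldr _∨_ false (map (λ u → S u ∧ adj G u v) xs)) → ∃[ u ] (u ∈ S × T (adj G u v))
    find (x ∷ xs) t with Equivalence.to (T-∨ {x = S x ∧ adj G x v}) t
    ... | inj₁ h = x , Equivalence.to T-∧ h
    ... | inj₂ t = find xs t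

  ∈-closedNbhd-self : ∀ {G : Graph n} {v} → v ∈ S → v ∈ closedNbhd G S
  ∈-closedNbhd-self v∈S = Equivalence.from T-∨ (inj₁ v∈S)

  ∈-closedNbhd-adj : ∀ {G : Graph n} {u v} → u ∈ S → T (adj G u v) → v ∈ closedNbhd G S
  ∈-closedNbhd-adj {G} {u} {v} u∈S uv = Equivalence.from (T-∨ {x = S v}) (inj₂ (found (∈-allFin u)))
    where
    found : ∀ {xs} → u ∈ᴸ xs → T (foldr _∨_ false (map (λ u → S u ∧ adj G u v) xs))
    found (here refl)            = Equivalence.from (T-∨ {x = S u ∧ adj G u v}) (inj₁ (Equivalence.from T-∧ (u∈S , uv)))
    found {x ∷ _} (there u∈xs)   = Equivalence.from (T-∨ {x = S x ∧ adj G x v}) (inj₂ (found u∈xs))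

-- Edge sets and mitigation

module EdgeSets {n : ℕ} (G : Graph n) where

  open Pairings G using (Adj; Adj-sym; Adj-irrefl)

  Mem : EdgeSet G → Fin n → Fin n → Set
  Mem S u v = T (mem S u v)

  mem? : ∀ S u → Decidable (Mem S u)
  mem? S u v = T? (mem S u v)

  Mem-sym : ∀ S {u v} → Mem S u v → Mem S v u
  Mem-sym S {u} {v} = subst T (memSym S u v)

  Mem⇒Adj : ∀ S {u v} → Mem S u v → Adj u v
  Mem⇒Adj S {u} {v} = ≡⇒T ∘ memAdj S u v ∘ T⇒≡

  Mem-irrefl : ∀ S {u v} → Mem S u v → u ≢ v
  Mem-irrefl S = Adj-irrefl ∘ Mem⇒Adj S

  module _ {R : Fin n → Fin n → Set} (R? : ∀ u v → Dec (R u v))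
           (R-sym : ∀ {u v} → R u v → R v u) (R⇒Adj : ∀ {u v} → R u v → Adj u v) where

    fromRelation : EdgeSet G
    fromRelation = record
      { mem    = λ u v → isYes (R? u v)
      ; memSym = λ u v → T-injective (flip {u} {v}) (flip {v} {u})
      ; memAdj = λ u v → T⇒≡ ∘ R⇒Adj ∘ toWitness ∘ ≡⇒T
      }
      where
      flip : ∀ {u v} → T (isYes (R? u v)) → T (isYes (R? v u))
      flip = fromWitness ∘ R-sym ∘ toWitness

  -- `size` counts an edge only in the orientation with increasing indices, and exactly one of the
  -- two orientations is such.
  handshake : ∀ S → ∑ (λ v → # (mem? S v)) ≡ 2 * size S
  handshake S = begin
    ∑ (λ u → ∑ (λ v → 𝟙 (mem? S u v)))                               ≡⟨ ∑-cong (λ u → ≡.trans (∑-cong (orient u)) (∑-+ _ _)) ⟩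
    ∑ (λ u → ∑ (λ v → up u v) + ∑ (λ v → up v u))                    ≡⟨ ∑-+ _ _ ⟩
    ∑ (λ u → ∑ (λ v → up u v)) + ∑ (λ u → ∑ (λ v → up v u))          ≡⟨ cong (∑ (λ u → ∑ (λ v → up u v)) +_) (∑-comm _) ⟩
    ∑ (λ u → ∑ (λ v → up u v)) + ∑ (λ u → ∑ (λ v → up u v))          ≡⟨ cong (λ s → s + s) (≡.sym size≡) ⟩
    size S + size S                                                  ≡⟨ cong (size S +_) (+-identityʳ _) ⟨
    2 * size S                                                       ∎
    where
    open ≡.≡-Reasoning
    up? : ∀ u v → Dec (T (mem S u v ∧ (toℕ u <ᵇ toℕ v)))
    up? u v = T? (mem S u v ∧ (toℕ u <ᵇ toℕ v))
    up : Fin n → Fin n → ℕ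
    up u v = 𝟙 (up? u v)
    size≡ : size S ≡ ∑ (λ u → ∑ (λ v → up u v))
    size≡ = ≡.trans (∑-unfold (λ u → count (λ v → mem S u v ∧ (toℕ u <ᵇ toℕ v)))) (∑-cong (λ u → ∑-unfold _))
    up⁺ : ∀ {u v} → Mem S u v → toℕ u < toℕ v → up u v ≡ 1
    up⁺ {u} {v} uv u<v = 𝟙-true (up? u v) (Equivalence.from T-∧ (uv , <⇒<ᵇ u<v))
    up⁻ : ∀ {u v} → ¬ (Mem S u v × toℕ u < toℕ v) → up u v ≡ 0
    up⁻ {u} {v} ¬up = 𝟙-false (up? u v) λ t → let uv , u<ᵇv = Equivalence.to T-∧ t in ¬up (uv , <ᵇ⇒< (toℕ u) (toℕ v) u<ᵇv)
    orient : ∀ u v → 𝟙 (mem? S u v) ≡ up u v + up v u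
    orient u v = 𝟙-cases (λ b → b ≡ up u v + up v u) (mem? S u v)
      (λ uv → case <-cmp (toℕ u) (toℕ v) of λ where
        (tri< u<v _ u≯v) → ≡.sym (cong₂ _+_ (up⁺ uv u<v) (up⁻ (u≯v ∘ proj₂)))
        (tri≈ _ u≡v _)   → contradiction (Fin.toℕ-injective u≡v) (Mem-irrefl S uv)
        (tri> u≮v _ u>v) → ≡.sym (cong₂ _+_ (up⁻ (u≮v ∘ proj₂)) (up⁺ (Mem-sym S uv) u>v)))
      (λ ¬uv → ≡.sym (cong₂ _+_ (up⁻ (¬uv ∘ proj₁)) (up⁻ (¬uv ∘ Mem-sym S ∘ proj₁))))

  size-cong : ∀ {S S′ : EdgeSet G} → (∀ i j → mem S i j ≡ mem S′ i j) → size S ≡ size S′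
  size-cong {S} {S′} S≗S′ = cong sum (map-cong (λ i →
    cong sum (map-cong (λ j → cong (λ b → if b ∧ (toℕ i <ᵇ toℕ j) then 1 else 0) (S≗S′ i j)) (allFin n))) (allFin n))

  removed-degree : ∀ S v → degA (removeA S) v + degA (mem S) v ≡ deg G v
  removed-degree S v = begin
    degA (removeA S) v + degA (mem S) v                          ≡⟨ cong₂ _+_ (degree≡∣∣ (removeA S) v) (degree≡∣∣ (mem S) v) ⟩
    ∣ removeA S v ∣ + ∣ mem S v ∣                                 ≡⟨ ∑-+ _ _ ⟨
    ∑ (λ w → 𝟙 (T? (removeA S v w)) + 𝟙 (T? (mem S v w)))        ≡⟨ ∑-cong pointwise ⟩
    ∣ adj G v ∣                                                   ≡⟨ degree≡∣∣ (adj G) v ⟨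
    deg G v                                                      ∎
    where
    open ≡.≡-Reasoning
    pointwise : ∀ w → 𝟙 (T? (removeA S v w)) + 𝟙 (T? (mem S v w)) ≡ 𝟙 (T? (adj G v w))
    pointwise w = split (adj G v w) (mem S v w) (Mem⇒Adj S)
      where
      split : ∀ a m → (T m → T a) → 𝟙 (T? (a ∧ not m)) + 𝟙 (T? m) ≡ 𝟙 (T? a)
      split true  true  _   = refl
      split true  false _   = refl
      split false false _   = refl
      split false true  m⇒a = ⊥-elim (m⇒a tt)

  -- Only core vertices must lose an edge. The premise `1 ≤ Δ G` exempts edgeless graphs, where
  -- truncated subtraction makes every edge set mitigating.
  mitigating⁺ : ∀ S → (∀ v → InCore G v → 1 ≤ Δ G → 1 ≤ degA (mem S) v) → Mitigating G S
  mitigating⁺ S covers = Δ-lub (removeA S) λ v →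
    drop (removed-degree S v) (degree-≤-Δ (adj G) v) (covers v)
    where
    drop : ∀ {r m d D} → r + m ≡ d → d ≤ D → (d ≡ D → 1 ≤ D → 1 ≤ m) → r ≤ D ∸ 1
    drop {r} {m} {D = zero}  refl d≤D _ = ≤-trans (m≤m+n r m) d≤D
    drop {r} {m} {D = suc D} refl d≤D covered with m≤n⇒m<n∨m≡n d≤D
    ... | inj₁ d<D = ≤-trans (m≤m+n r m) (≤-pred d<D)
    ... | inj₂ d≡D = ≤-pred (≤-trans (≤-trans (≤-reflexive (+-comm 1 r)) (+-monoʳ-≤ r (covered d≡D (s≤s z≤n)))) d≤D)

  -- An upper bound k in place of the maximum degree allows the use in an induced subgraph with k
  -- the maximum degree of the whole graph.
  mitigating⁻ : ∀ S {k} → 1 ≤ k → Δ G ≤ k → Mitigating G S → ∀ {v} → deg G v ≡ k → ∃[ w ] Mem S v w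
  mitigating⁻ S {k} 1≤k Δ≤k mitigating {v} deg≡k with 1 ≤? # (mem? S v)
  ... | yes 1≤ = #-witness (mem? S v) 1≤
  ... | no  1≰ = contradiction (≤-trans (≤-reflexive k≡) (≤-trans (degree-≤-Δ (removeA S) v) (≤-trans mitigating (∸-monoˡ-≤ 1 Δ≤k))))
                   (<⇒≱ (∸-monoʳ-< {k} (s≤s z≤n) 1≤k))
    where
    k≡ : k ≡ degA (removeA S) v
    k≡ = ≡.trans (≡.trans (≡.sym deg≡k) (≡.sym (removed-degree S v)))
           (≡.trans (cong (degA (removeA S) v +_) (≡.trans (degree≡∣∣ (mem S) v) (n<1⇒n≡0 (≰⇒> 1≰)))) (+-identityʳ _))

  -- A search over Boolean vectors of length `n * n`; each one decodes after being made symmetric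
  -- and confined to `adj G`. Encoding is undone only up to pointwise equality, which P must
  -- therefore respect.
  anyEdgeSet? : ∀ {P : EdgeSet G → Set} → (∀ S → Dec (P S)) →
                (∀ {S S′} → (∀ i j → mem S i j ≡ mem S′ i j) → P S → P S′) → Dec (∃ P)
  anyEdgeSet? {P} P? P-resp = map′ (λ (p , Pp) → decode p , Pp) encode (anySubset? (P? ∘ decode))
    where
    Coded : Vec Bool (n * n) → Fin n → Fin n → Set
    Coded p i j = T (lookup p (combine i j)) × T (lookup p (combine j i)) × Adj i j
    coded? : ∀ p i j → Dec (Coded p i j)
    coded? p i j = T? (lookup p (combine i j)) ×-dec (T? (lookup p (combine j i)) ×-dec T? (adj G i j))
    decode : Vec Bool (n * n) → EdgeSet G
    decode p = fromRelation (coded? p) (λ (a , b , c) → b , a , Adj-sym c) (proj₂ ∘ proj₂)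
    encode : ∃ P → ∃ (P ∘ decode)
    encode (S , PS) = code , P-resp (λ i j → T-injective
        (λ ij → fromWitness {a? = coded? code i j} (coded ij , coded (Mem-sym S ij) , Mem⇒Adj S ij))
        (λ t → subst T (lookup-code i j) (proj₁ (toWitness {a? = coded? code i j} t)))) PS
      where
      entry : Fin (n * n) → Bool
      entry k = let i , j = remQuot n k in mem S i j
      code = Vec.tabulate entry
      lookup-code : ∀ i j → lookup code (combine i j) ≡ mem S i j
      lookup-code i j = ≡.trans (lookup∘tabulate entry (combine i j)) (cong (λ (i , j) → mem S i j) (Fin.remQuot-combine i j))
      coded : ∀ {i j} → Mem S i j → T (lookup code (combine i j))
      coded {i} {j} = subst T (≡.sym (lookup-code i j))

  -- Descent in size from the full edge set; each step is decided by finite search.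
  minimum-mitigating : ∃ (MinMitigating G)
  minimum-mitigating = descend (suc (size all)) all all-mitigating ≤-refl
    where
    all : EdgeSet G
    all = record { mem = adj G ; memSym = sym G ; memAdj = λ _ _ → id }
    all-mitigating : Mitigating G all
    all-mitigating = mitigating⁺ all λ v core 1≤Δ → ≤-trans 1≤Δ (≤-reflexive (≡.sym core))
    smaller? : ∀ S → Dec (∃[ S′ ] (Mitigating G S′ × size S′ < size S))
    smaller? S = anyEdgeSet? (λ S′ → ΔA (removeA S′) ≤? Δ G ∸ 1 ×-dec size S′ <? size S) λ {S₁} {S₂} S₁≗S₂ (mit , less) →
      subst (_≤ Δ G ∸ 1) (ΔA-cong λ i j → cong (λ b → adj G i j ∧ not b) (S₁≗S₂ i j)) mit ,
      subst (_< size S) (size-cong {S₁} {S₂} S₁≗S₂) less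
    descend : ∀ fuel S → Mitigating G S → size S < fuel → ∃ (MinMitigating G)
    descend (suc fuel) S mit (s≤s S≤fuel) with smaller? S
    ... | yes (S′ , mit′ , less) = descend fuel S′ mit′ (<-≤-trans less S≤fuel)
    ... | no none = S , mit , λ S′ mit′ → ≮⇒≥ (λ less → none (S′ , mit′ , less))

  -- Decidability lets (3) ⇒ (1) be proved by contradiction with classical steps.
  cond1? : Dec (Cond1 G)
  cond1? = anyEdgeSet?
    (λ S → Fin.all? (λ v → degA (mem S) v ≤? 1) ×-dec
           Fin.all? (λ v → (deg G v ℕ.≟ Δ G) →-dec (1 ≤? degA (mem S) v)))
    λ S≗S′ (matching , saturates) →
      (λ v → subst (_≤ 1) (degA-cong S≗S′ v) (matching v)) ,
      (λ v core → subst (1 ≤_) (degA-cong S≗S′ v) (saturates v core))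

-- The equivalences

module _ {n : ℕ} (G : Graph n) (1≤Δ : 1 ≤ Δ G) where

  open EdgeSets G
  open Pairings G using (Adj)

  Covers : EdgeSet G → Set
  Covers S = ∀ {v} → InCore G v → ∃[ w ] Mem S v w

  covers⇒mitigating : ∀ S → Covers S → Mitigating G S
  covers⇒mitigating S covers = mitigating⁺ S λ v core _ →
    ≤-trans (#-positive (mem? S v) (proj₂ (covers core))) (≤-reflexive (≡.sym (degree≡∣∣ (mem S) v)))

  mitigating⇒covers : ∀ S → Mitigating G S → Covers S
  mitigating⇒covers S = λ mit → mitigating⁻ S 1≤Δ ≤-refl mit

  outside? : ∀ (M S : EdgeSet G) i → Decidable (λ j → Mem S i j × ¬ Mem M i j)
  outside? M S i j = mem? S i j ×-dec ¬? (mem? M i j)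

  -- Twice the number of edges of S outside M, the measure that each redirection decreases.
  outside : EdgeSet G → EdgeSet G → ℕ
  outside M S = ∑ (λ i → # (outside? M S i))

  -- Replaces the edge vu of S by the M-edge at u, if any.
  module Redirect (M : EdgeSet G) (M-matching : ∀ v → # (mem? M v) ≤ 1) (M-covers : Covers M)
                  (S : EdgeSet G) {v u u′ : Fin n} (u≢u′ : u ≢ u′)
                  (vu : Mem S v u) (vu′ : Mem S v u′) (¬vu∈M : ¬ Mem M v u) where

    v≢u : v ≢ u
    v≢u = Mem-irrefl S vu

    Dropped Added New : Fin n → Fin n → Set
    Dropped i j = (i ≡ v × j ≡ u) ⊎ (i ≡ u × j ≡ v)
    Added i j = Mem M i j × (i ≡ u ⊎ j ≡ u)
    New i j = (Mem S i j × ¬ Dropped i j) ⊎ Added i j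

    new? : ∀ i j → Dec (New i j)
    new? i j = (mem? S i j ×-dec ¬? ((i ≟ v ×-dec j ≟ u) ⊎-dec (i ≟ u ×-dec j ≟ v)))
               ⊎-dec (mem? M i j ×-dec (i ≟ u ⊎-dec j ≟ u))

    new-sym : ∀ {i j} → New i j → New j i
    new-sym (inj₁ (ij , kept)) = inj₁ (Mem-sym S ij , kept ∘ [ (λ (a , b) → inj₂ (b , a)) , (λ (a , b) → inj₁ (b , a)) ]′)
    new-sym (inj₂ (ij , at-u)) = inj₂ (Mem-sym M ij , [ inj₂ , inj₁ ]′ at-u)

    new⇒Adj : ∀ {i j} → New i j → Adj i j
    new⇒Adj = [ Mem⇒Adj S ∘ proj₁ , Mem⇒Adj M ∘ proj₁ ]′

    S′ : EdgeSet G
    S′ = fromRelation new? new-sym new⇒Adj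

    S′⁺ : ∀ {i j} → New i j → Mem S′ i j
    S′⁺ {i} {j} = fromWitness {a? = new? i j}

    S′⁻ : ∀ {i j} → Mem S′ i j → New i j
    S′⁻ {i} {j} = toWitness {a? = new? i j}

    -- A core vertex u is covered by its M-edge, v keeps its edge to u′, and every other vertex
    -- keeps all its S-edges.
    S′-covers : Covers S → Covers S′
    S′-covers S-covers {x} core = case x ≟ u of λ where
      (yes refl) → let w , uw = M-covers core in w , S′⁺ (inj₂ (uw , inj₁ refl))
      (no x≢u) → case x ≟ v of λ where
        (yes refl) → u′ , S′⁺ (inj₁ (vu′ , [ u≢u′ ∘ ≡.sym ∘ proj₂ , x≢u ∘ proj₁ ]′))
        (no x≢v)   → let w , xw = S-covers core in w , S′⁺ (inj₁ (xw , [ x≢v ∘ proj₁ , x≢u ∘ proj₁ ]′))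

    ¬vu∈S′ : ¬ New v u
    ¬vu∈S′ = [ (λ (_ , kept) → kept (inj₁ (refl , refl))) , ¬vu∈M ∘ proj₁ ]′

    -- Row v only loses, row u trades v for at most its M-partner, and any other row gains at most
    -- u, and only at the M-partner of u. As there is at most one such partner, the loss at v pays.
    size≤ : ∑ (λ i → # (mem? S′ i)) ≤ ∑ (λ i → # (mem? S i))
    size≤ = ∑-shift _ _ (≤-trans (M-matching u) (≤-reflexive (≡.sym (∑-point v)))) rows
      where
      rows : ∀ i → # (mem? S′ i) + 𝟙 (i ≟ v) ≤ # (mem? S i) + 𝟙 (mem? M u i)
      rows i = 𝟙-cases (λ b → # (mem? S′ i) + b ≤ # (mem? S i) + 𝟙 (mem? M u i)) (i ≟ v)
        (λ { refl → ≤-trans (≤-reflexive (+-comm _ 1)) (≤-trans row-v (m≤m+n _ _)) })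
        (λ _ → ≤-trans (≤-reflexive (+-identityʳ _)) (case i ≟ u of λ where
          (yes refl) → ≤-trans row-u (m≤m+n _ _)
          (no i≢u)   → row-other i≢u))
        where
        row-v : # (mem? S′ v) < # (mem? S v)
        row-v = #-mono-< (mem? S′ v) (mem? S v) (λ j → kept ∘ S′⁻) vu (¬vu∈S′ ∘ S′⁻)
          where
          kept : ∀ {j} → New v j → Mem S v j
          kept (inj₁ (vj , _))           = vj
          kept (inj₂ (_ , inj₁ v≡u))     = contradiction v≡u v≢u
          kept (inj₂ (vu∈M , inj₂ refl)) = contradiction vu∈M ¬vu∈M

        row-u : # (mem? S′ u) ≤ # (mem? S u)
        row-u with Fin.any? (mem? M u)
        ... | yes (w , uw) = #-exchange (mem? S′ u) (mem? S u)
                (λ j uj → [ inj₁ ∘ proj₁ , (λ (uj∈M , _) → inj₂ (#-unique (mem? M u) (M-matching u) uj∈M uw)) ]′ (S′⁻ uj))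
                (Mem-sym S vu) (¬vu∈S′ ∘ new-sym ∘ S′⁻)
        ... | no none = #-mono (mem? S′ u) (mem? S u)
                (λ j uj → [ proj₁ , (λ (uj∈M , _) → contradiction (j , uj∈M) none) ]′ (S′⁻ uj))

        row-other : ∀ {i} → i ≢ u → # (mem? S′ i) ≤ # (mem? S i) + 𝟙 (mem? M u i)
        row-other {i} i≢u = 𝟙-cases (λ b → # (mem? S′ i) ≤ # (mem? S i) + b) (mem? M u i)
          (λ _ → ≤-trans (#-insert (mem? S′ i) (mem? S i) λ j → gain ∘ S′⁻) (≤-reflexive (+-comm 1 _)))
          (λ ¬ui → ≤-trans (#-mono (mem? S′ i) (mem? S i) λ j → kept ¬ui ∘ S′⁻) (≤-reflexive (≡.sym (+-identityʳ _))))
          where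
          gain : ∀ {j} → New i j → Mem S i j ⊎ j ≡ u
          gain (inj₁ (ij , _))       = inj₁ ij
          gain (inj₂ (_ , inj₁ i≡u)) = contradiction i≡u i≢u
          gain (inj₂ (_ , inj₂ j≡u)) = inj₂ j≡u
          kept : ¬ Mem M u i → ∀ {j} → New i j → Mem S i j
          kept _   (inj₁ (ij , _))         = ij
          kept _   (inj₂ (_ , inj₁ i≡u))   = contradiction i≡u i≢u
          kept ¬ui (inj₂ (iu , inj₂ refl)) = contradiction (Mem-sym M iu) ¬ui

    fewer-outside : outside M S′ < outside M S
    fewer-outside = ∑-mono-< _ _ v (λ i → #-mono (outside? M S′ i) (outside? M S i) (kept i))
      (#-mono-< (outside? M S′ v) (outside? M S v) (kept v) (vu , ¬vu∈M) (¬vu∈S′ ∘ S′⁻ ∘ proj₁))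
      where
      kept : ∀ i j → Mem S′ i j × ¬ Mem M i j → Mem S i j × ¬ Mem M i j
      kept i j (ij , ¬ij∈M) = [ proj₁ , (λ (ij∈M , _) → contradiction ij∈M ¬ij∈M) ]′ (S′⁻ ij) , ¬ij∈M

  degree-sum-≤⇒size-≤ : ∀ S S′ → ∑ (λ i → # (mem? S′ i)) ≤ ∑ (λ i → # (mem? S i)) → size S′ ≤ size S
  degree-sum-≤⇒size-≤ S S′ ≤ = *-cancelˡ-≤ 2 (≡.subst₂ _≤_ (handshake S′) (handshake S) ≤)

  -- As long as a vertex v has two neighbours in S, one of them is not its
  -- M-partner, and redirecting the edge to it brings S closer to M.
  covering-matching : ∀ (M : EdgeSet G) → IsMatching M → Covers M →
                      ∀ S → Covers S → ∃[ S′ ] (Covers S′ × IsMatching S′ × size S′ ≤ size S)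
  covering-matching M M-matching M-covers S₀ S₀-covers = go _ S₀ S₀-covers (n<1+n _)
    where
    M≤1 : ∀ v → # (mem? M v) ≤ 1
    M≤1 v = ≤-trans (≤-reflexive (≡.sym (degree≡∣∣ (mem M) v))) (M-matching v)

    two-neighbours : ∀ S v → 2 ≤ # (mem? S v) → ∃[ u ] ∃[ u′ ] (u ≢ u′ × Mem S v u × Mem S v u′ × ¬ Mem M v u)
    two-neighbours S v 2≤ with #≥2-witnesses (mem? S v) 2≤
    ... | u , u′ , u≢u′ , vu , vu′ with mem? M v u
    ...   | no ¬vu∈M = u , u′ , u≢u′ , vu , vu′ , ¬vu∈M
    ...   | yes vu∈M = u′ , u , u≢u′ ∘ ≡.sym , vu′ , vu , λ vu′∈M → u≢u′ (#-unique (mem? M v) (M≤1 v) vu∈M vu′∈M)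

    go : ∀ fuel S → Covers S → outside M S < fuel →
         ∃[ S′ ] (Covers S′ × IsMatching S′ × size S′ ≤ size S)
    go (suc fuel) S S-covers (s≤s bound) with Fin.any? (λ v → 2 ≤? # (mem? S v))
    ... | no none = S , S-covers ,
          (λ v → ≤-trans (≤-reflexive (degree≡∣∣ (mem S) v)) (≤-pred (≰⇒> (λ 2≤ → none (v , 2≤))))) , ≤-refl
    ... | yes (v , 2≤) =
      let u , u′ , u≢u′ , vu , vu′ , ¬vu∈M = two-neighbours S v 2≤
          open Redirect M M≤1 M-covers S u≢u′ vu vu′ ¬vu∈M
          S″ , S″-covers , S″-matching , S″≤S′ = go fuel S′ (S′-covers S-covers) (<-≤-trans fewer-outside bound)
      in S″ , S″-covers , S″-matching , ≤-trans S″≤S′ (degree-sum-≤⇒size-≤ S S′ size≤)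

  saturates⇒covers : ∀ M → (∀ v → InCore G v → Saturates M v) → Covers M
  saturates⇒covers M saturates {v} core =
    #-witness (mem? M v) (≤-trans (saturates v core) (≤-reflexive (degree≡∣∣ (mem M) v)))

  covers⇒saturates : ∀ M → Covers M → ∀ v → InCore G v → Saturates M v
  covers⇒saturates M covers v core =
    ≤-trans (#-positive (mem? M v) (proj₂ (covers core))) (≤-reflexive (≡.sym (degree≡∣∣ (mem M) v)))

  cond1⇒cond2 : Cond1 G → Cond2 G
  cond1⇒cond2 (M , M-matching , M-saturates) =
    let S , S-mit , S-min = minimum-mitigating
        S′ , S′-covers , S′-matching , S′≤S =
          covering-matching M M-matching (saturates⇒covers M M-saturates) S (mitigating⇒covers S S-mit)
    in S′ , (covers⇒mitigating S′ S′-covers , λ R R-mit → ≤-trans S′≤S (S-min R R-mit)) , S′-matching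

  cond2⇒cond1 : Cond2 G → Cond1 G
  cond2⇒cond1 (S , (S-mit , _) , S-matching) = S , S-matching , covers⇒saturates S (mitigating⇒covers S S-mit)

-- Classical principles under double negation

¬¬-∀ : ∀ {n} {P : Fin n → Set} → (∀ i → ¬ ¬ P i) → ¬ ¬ (∀ i → P i)
¬¬-∀ {zero}  h k = k λ ()
¬¬-∀ {suc n} h k = h zero λ p → ¬¬-∀ (h ∘ suc) λ ps → k (Fin.∀-cons p ps)

-- Values in ℕ cannot descend forever; whether a smaller one exists is decided only under double
-- negation.
¬¬-minimum : ∀ {A : Set} (f : A → ℕ) → A → ¬ ¬ (∃[ a ] (∀ b → f a ≤ f b))
¬¬-minimum {A} f a k = descend (suc (f a)) a ≤-refl
  where
  descend : ∀ fuel a → ¬ (f a < fuel)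
  descend (suc fuel) a (s≤s fa≤fuel) = ¬¬-excluded-middle {A = ∃[ b ] (f b < f a)} λ where
    (yes (b , fb<fa)) → descend fuel b (<-≤-trans fb<fa fa≤fuel)
    (no none)         → k (a , λ b → ≮⇒≥ (λ fb<fa → none (b , fb<fa)))

-- Degrees in induced subgraphs

module _ {n : ℕ} (G : Graph n) (X : VSet n) where

  open Pairings G using (Adj)

  induced-adj⁺ : ∀ {u v} → Adj u v → u ∈ X → v ∈ X → T (adj (induced G X) u v)
  induced-adj⁺ uv u∈X v∈X = Equivalence.from T-∧ (uv , Equivalence.from T-∧ (u∈X , v∈X))

  induced-adj⁻ : ∀ {u v} → T (adj (induced G X) u v) → Adj u v × u ∈ X × v ∈ X
  induced-adj⁻ t = let uv , uv∈X = Equivalence.to T-∧ t in uv , Equivalence.to T-∧ uv∈X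

  private
    adj? : ∀ v → Decidable (Adj v)
    adj? v w = T? (adj G v w)

    induced-adj? : ∀ v → Decidable (λ w → T (adj (induced G X) v w))
    induced-adj? v w = T? (adj (induced G X) v w)

  induced-degree-≤ : ∀ v → deg (induced G X) v ≤ deg G v
  induced-degree-≤ v = ≡.subst₂ _≤_ (≡.sym (degree≡∣∣ (adj (induced G X)) v)) (≡.sym (degree≡∣∣ (adj G) v))
    (#-mono (induced-adj? v) (adj? v) λ w → proj₁ ∘ induced-adj⁻)

  induced-degree-≡ : ∀ {v} → v ∈ X → (∀ {w} → Adj v w → w ∈ X) → deg (induced G X) v ≡ deg G v
  induced-degree-≡ {v} v∈X nbrs∈X = ≤-antisym (induced-degree-≤ v)
    (≡.subst₂ _≤_ (≡.sym (degree≡∣∣ (adj G) v)) (≡.sym (degree≡∣∣ (adj (induced G X)) v))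
      (#-mono (adj? v) (induced-adj? v) λ w vw → induced-adj⁺ vw v∈X (nbrs∈X vw)))

  -- Losing the edge vw would make the induced degree strictly smaller.
  induced-degree-full : ∀ {v w} → deg G v ≤ deg (induced G X) v → Adj v w → v ∈ X × w ∈ X
  induced-degree-full {v} {w} full vw with induced-adj? v w
  ... | yes t = proj₂ (induced-adj⁻ t)
  ... | no ¬t = contradiction (≡.subst₂ _≤_ (degree≡∣∣ (adj G) v) (degree≡∣∣ (adj (induced G X)) v) full)
                  (<⇒≱ (#-mono-< (induced-adj? v) (adj? v) (λ _ → proj₁ ∘ induced-adj⁻) vw ¬t))

  induced-Δ-≤ : Δ (induced G X) ≤ Δ G
  induced-Δ-≤ = Δ-lub (adj (induced G X)) λ v → ≤-trans (induced-degree-≤ v) (degree-≤-Δ (adj G) v)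

-- Condition (3) and saturating matchings

module _ {n : ℕ} (G : Graph n) (1≤Δ : 1 ≤ Δ G) where

  open Pairings G
  open EdgeSets G using (Mem; mem?; Mem-sym; Mem⇒Adj)

  cond1⇒cond3 : Cond1 G → Cond3 G
  cond1⇒cond3 (M , M-matching , M-saturates) S S⊆core k (R , (_ , R-min) , refl) = begin
    2 * size R                    ≤⟨ *-monoʳ-≤ 2 (R-min M∩H M∩H-mitigating) ⟩
    2 * size M∩H                  ≡⟨ H.handshake M∩H ⟨
    ∑ (λ v → # (H.mem? M∩H v))    ≤⟨ ∑-mono row ⟩
    ∣ X ∣                          ≡⟨ count≡∣∣ X ⟨
    count X                       ∎
    where
    open ≤-Reasoning
    X : VSet n
    X = closedNbhd G S
    H : Graph n
    H = induced G X
    module H = EdgeSets H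

    within? : ∀ u v → Dec (Mem M u v × u ∈ X × v ∈ X)
    within? u v = mem? M u v ×-dec (u ∈? X ×-dec v ∈? X)

    M∩H : EdgeSet H
    M∩H = H.fromRelation within? (λ (uv , u∈X , v∈X) → Mem-sym M uv , v∈X , u∈X)
      (λ (uv , u∈X , v∈X) → induced-adj⁺ G X (Mem⇒Adj M uv) u∈X v∈X)

    -- The restricted matching has degree at most 1 on X and 0 elsewhere; summed, this is the bound
    -- |N[S]|.
    row : ∀ v → # (H.mem? M∩H v) ≤ 𝟙 (v ∈? X)
    row v = 𝟙-cases (# (H.mem? M∩H v) ≤_) (v ∈? X)
      (λ _ → ≤-trans (#-mono (H.mem? M∩H v) (mem? M v) λ w → proj₁ ∘ toWitness {a? = within? v w})
               (≤-trans (≤-reflexive (≡.sym (degree≡∣∣ (mem M) v))) (M-matching v)))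
      (λ v∉X → ≤-reflexive (∑-zero λ w → 𝟙-false (H.mem? M∩H v w) (v∉X ∘ proj₁ ∘ proj₂ ∘ toWitness {a? = within? v w})))

    -- A core vertex in S keeps all its neighbours in N[S], hence its full degree.
    Δ≤ΔH : ∀ {s} → s ∈ S → Δ G ≤ Δ H
    Δ≤ΔH {s} s∈S = ≤-trans (≤-reflexive (≡.trans (≡.sym (S⊆core s (T⇒≡ s∈S)))
        (≡.sym (induced-degree-≡ G X (∈-closedNbhd-self S {G} s∈S) (∈-closedNbhd-adj S {G} s∈S)))))
      (degree-≤-Δ (adj H) s)

    M∩H-mitigating : Mitigating H M∩H
    M∩H-mitigating = H.mitigating⁺ M∩H covered
      where
      covered : ∀ v → InCore H v → 1 ≤ Δ H → 1 ≤ degA (mem M∩H) v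
      covered v v-core 1≤ΔH =
        let w , vw = #-witness (mem? M v) (≤-trans (M-saturates v core) (≤-reflexive (degree≡∣∣ (mem M) v)))
        in ≤-trans (#-positive (H.mem? M∩H v)
             (fromWitness {a? = within? v w} (vw , induced-degree-full G X full (Mem⇒Adj M vw))))
             (≤-reflexive (≡.sym (degree≡∣∣ (mem M∩H) v)))
        where
        -- A vertex with an edge in H lies in X, so S is nonempty and H reaches the maximum degree
        -- of G; thus v is in the core of G and its M-partner is in X.
        v∈X : v ∈ X
        v∈X = let w , t = #-witness (λ w → T? (adj H v w))
                    (≤-trans 1≤ΔH (≤-reflexive (≡.trans (≡.sym v-core) (degree≡∣∣ (adj H) v))))
              in proj₁ (proj₂ (induced-adj⁻ G X t))
        Δ≤deg : Δ G ≤ deg H v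
        Δ≤deg = ≤-trans ([ Δ≤ΔH , (λ (_ , s∈S , _) → Δ≤ΔH s∈S) ]′ (∈-closedNbhd⁻ S {G} v∈X)) (≤-reflexive (≡.sym v-core))
        full : deg G v ≤ deg H v
        full = ≤-trans (degree-≤-Δ (adj G) v) Δ≤deg
        core : InCore G v
        core = ≤-antisym (degree-≤-Δ (adj G) v) (≤-trans Δ≤deg (induced-degree-≤ G X v))

  core : VSet n
  core v = isYes (deg G v ℕ.≟ Δ G)

  ∈-core⁻ : ∀ {v} → v ∈ core → InCore G v
  ∈-core⁻ {v} = toWitness {a? = deg G v ℕ.≟ Δ G}

  ∈-core⁺ : ∀ {v} → InCore G v → v ∈ core
  ∈-core⁺ {v} = fromWitness {a? = deg G v ℕ.≟ Δ G}

  pairing⇒cond1 : ∀ m → (∀ {v} → v ∈ core → ¬ Missed m v) → Cond1 G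
  pairing⇒cond1 m saturating = M , M-matching , M-saturates
    where
    paired? : ∀ u v → Dec (partner m u ≡ v × u ≢ v)
    paired? u v = partner m u ≟ v ×-dec ¬? (u ≟ v)
    M : EdgeSet G
    M = EdgeSets.fromRelation G paired? (λ (e , u≢v) → partner-swap m e , u≢v ∘ ≡.sym)
      (λ { (refl , u≢) → edge m (u≢ ∘ ≡.sym) })
    M-matching : IsMatching M
    M-matching v = ≤-trans (≤-reflexive (degree≡∣∣ (mem M) v)) (#≤1 (mem? M v) λ {u} {w} vu vw →
      ≡.trans (≡.sym (proj₁ (toWitness {a? = paired? v u} vu))) (proj₁ (toWitness {a? = paired? v w} vw)))
    M-saturates : ∀ v → InCore G v → Saturates M v
    M-saturates v v-core = ≤-trans
      (#-positive (mem? M v) (fromWitness {a? = paired? v (partner m v)} (refl , saturating (∈-core⁺ v-core) ∘ ≡.sym)))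
      (≤-reflexive (≡.sym (degree≡∣∣ (mem M) v)))

  module _ (cond3 : Cond3 G) where

    critical-⊥ : ∀ U K (lower : ∀ m → Avoids U m → K ≤ deficiency (core ∖ U) m) → ∣ U ∣ < K →
      (∀ u v → Dec (Critical.Coexposed G core U K lower u v)) →
      (∀ a → a ∉ U → ¬ ¬ (∃[ M ] (Avoids (insert a U) M × deficiency (core ∖ insert a U) M ≤ K))) →
      ∀ M → ¬ Critical.Optimal G core U K lower M
    critical-⊥ U K lower U<K coexposed? inessential M optM = <-irrefl refl (begin-strict
      # inD? + K                         ≤⟨ degree-sum M optM ⟩
      ∑ (λ v → # (nbr? v))               ≡⟨ H.handshake F ⟩
      2 * size F                         ≤⟨ cond3 D D⊆core (size F) (F , F-min , refl) ⟩
      count X                            ≡⟨ count≡∣∣ X ⟩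
      ∣ X ∣                               ≤⟨ #-⊎ (_∈? X) inD? (_∈? U) X⇒D⊎U ⟩
      # inD? + ∣ U ∣                      <⟨ +-monoʳ-< (# inD?) U<K ⟩
      # inD? + K                         ∎)
      where
      open ≤-Reasoning
      open Critical G core U K lower
      open Classes coexposed? inessential
      D : VSet n
      D v = isYes (inD? v)
      X : VSet n
      X = closedNbhd G D
      H : Graph n
      H = induced G X
      module H = EdgeSets H
      F : EdgeSet H
      F = proj₁ H.minimum-mitigating
      F-min : MinMitigating H F
      F-min = proj₂ H.minimum-mitigating
      D⁺ : ∀ {v} → InD v → v ∈ D
      D⁺ {v} = fromWitness {a? = inD? v}
      D⁻ : ∀ {v} → v ∈ D → InD v
      D⁻ {v} = toWitness {a? = inD? v}
      inD⇒core : ∀ {v} → InD v → InCore G v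
      inD⇒core (v∈W , _) = ∈-core⁻ (proj₁ (∈-∖⁻ core U v∈W))
      D⊆core : D ⊆core G
      D⊆core v v∈D = inD⇒core (D⁻ (≡⇒T v∈D))
      -- Vertices of D retain degree `Δ G` in H, so a mitigating set has to touch them.
      F-covers : ∀ {v} → InD v → ∃[ w ] H.Mem F v w
      F-covers {v} v∈D = H.mitigating⁻ F 1≤Δ (induced-Δ-≤ G X) (proj₁ F-min)
        (≡.trans (induced-degree-≡ G X (∈-closedNbhd-self D {G} (D⁺ v∈D)) (∈-closedNbhd-adj D {G} (D⁺ v∈D))) (inD⇒core v∈D))
      open Cover (mem F) (λ {u} {v} → H.Mem-sym F {u} {v}) (λ uv → proj₁ (induced-adj⁻ G X (H.Mem⇒Adj F uv))) F-covers
      -- By `closed`, a neighbour of D outside `U` is in D; this bounds |N[D]| by |D| + |U|.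
      X⇒D⊎U : ∀ v → v ∈ X → InD v ⊎ v ∈ U
      X⇒D⊎U v v∈X with v ∈? U | ∈-closedNbhd⁻ D {G} v∈X
      ... | yes v∈U | _                   = inj₂ v∈U
      ... | no _    | inj₁ v∈D            = inj₁ (D⁻ v∈D)
      ... | no v∉U  | inj₂ (u , u∈D , uv) = inj₁ (closed (D⁻ u∈D) uv v∉U)

    ∉? : ∀ (U : VSet n) → Decidable (_∉ U)
    ∉? U v = ¬? (v ∈? U)

    -- Enlarges `U` until it is maximal. The fuel exceeds the number of vertices outside `U`, and M
    -- witnesses that the bound `K` is attained.
    grow : ∀ fuel U K → # (∉? U) < fuel → ∣ U ∣ < K →
           (∀ m → Avoids U m → K ≤ deficiency (core ∖ U) m) →
           ∀ M → Avoids U M → ¬ deficiency (core ∖ U) M ≤ K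
    grow (suc fuel) U K (s≤s bound) U<K lower M M-avoids M≤K =
      -- The goal is a negation, so whether `U` can still grow need not be decidable.
      ¬¬-excluded-middle {A = ∃[ a ] (a ∉ U × (∀ m → Avoids (insert a U) m → suc K ≤ deficiency (core ∖ insert a U) m))} λ where
        (yes (a , a∉U , lower′)) →
          grow fuel (insert a U) (suc K)
            (<-≤-trans (#-mono-< (∉? (insert a U)) (∉? U) (λ v v∉ → v∉ ∘ ∈-insert⁺ U ∘ inj₂) a∉U
              (λ a∉ → a∉ (∈-insert⁺ U (inj₁ refl)))) bound)
            (s≤s (≤-trans (#-insert (_∈? insert a U) (_∈? U) (λ v → [ inj₂ , inj₁ ]′ ∘ ∈-insert⁻ U)) U<K))
            lower′ (unmatch M a) (unmatched-avoids a) (unmatched-≤ a)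
        -- There are finitely many pairs, so coexposure may be assumed decidable for all of them at
        -- once.
        (no none) → ¬¬-∀ (λ u → ¬¬-∀ (λ v → ¬¬-excluded-middle)) λ coexposed? →
          critical-⊥ U K lower U<K coexposed?
            (λ a a∉U ¬∃ → none (a , a∉U , λ m avoids → ≰⇒> (λ m≤K → ¬∃ (m , avoids , m≤K))))
            M (M-avoids , M≤K)
      where
      unmatched-avoids : ∀ a → Avoids (insert a U) (unmatch M a)
      unmatched-avoids a v∈ with ∈-insert⁻ U v∈
      ... | inj₁ refl = unmatch-self M a
      ... | inj₂ v∈U  = unmatch-missed⁺ M a (M-avoids v∈U)
      -- Only the former partner of a is newly exposed, while a itself is no longer counted.
      unmatched-≤ : ∀ a → deficiency (core ∖ insert a U) (unmatch M a) ≤ suc K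
      unmatched-≤ a = ≤-trans (#-insert (exposed? (core ∖ insert a U) (unmatch M a)) (exposed? (core ∖ U) M)
        λ v (v∈ , missed) → let v∈C , v∉ = ∈-∖⁻ core (insert a U) v∈ in
          [ (λ Mv → inj₁ (∈-∖⁺ core U v∈C (v∉ ∘ ∈-insert⁺ U ∘ inj₂) , Mv)) , inj₂ ]′
            (unmatch-missed⁻ M a (v∉ ∘ ∈-insert⁺ U ∘ inj₁) missed)) (s≤s M≤K)

    cond3⇒cond1 : Cond1 G
    cond3⇒cond1 = decidable-stable (EdgeSets.cond1? G) λ ¬cond1 →
      ¬¬-minimum (deficiency (core ∖ ∅)) identity λ (M , M-min) →
        -- `U` starts empty and `K` is the least deficiency, positive because no matching saturates
        -- the core.
        grow _ ∅ (deficiency (core ∖ ∅) M) (n<1+n _)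
          (≤-<-trans (≤-reflexive (∑-zero {f = λ v → 𝟙 (v ∈? ∅)} λ _ → refl)) (exposing ¬cond1 M))
          (λ m _ → M-min m) M (λ ()) ≤-refl
      where
      ∅ : VSet n
      ∅ _ = false
      identity : Pairing
      identity = record { partner = id ; involutive = λ _ → refl ; edge = contradiction refl }
      exposing : ¬ Cond1 G → ∀ m → 0 < deficiency (core ∖ ∅) m
      exposing ¬cond1 m with 1 ≤? deficiency (core ∖ ∅) m
      ... | yes 1≤ = 1≤
      ... | no  1≰ = contradiction (pairing⇒cond1 m λ v∈core missed →
              1≰ (#-positive (exposed? (core ∖ ∅) m) (∈-∖⁺ core ∅ v∈core (λ ()) , missed))) ¬cond1

theorem2p3 : ∀ (n : ℕ) (G : Graph n) → HasEdge G →
    (Cond1 G ⇔ Cond2 G) × (Cond2 G ⇔ Cond3 G)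
theorem2p3 n G (i , j , ij) =
  mk⇔ (cond1⇒cond2 G 1≤Δ) (cond2⇒cond1 G 1≤Δ) ,
  mk⇔ (cond1⇒cond3 G 1≤Δ ∘ cond2⇒cond1 G 1≤Δ) (cond1⇒cond2 G 1≤Δ ∘ cond3⇒cond1 G 1≤Δ)
  where
  1≤Δ : 1 ≤ Δ G
  1≤Δ = ≤-trans (#-positive (λ w → T? (adj G i w)) (≡⇒T ij))
    (≤-trans (≤-reflexive (≡.sym (degree≡∣∣ (adj G) i))) (degree-≤-Δ (adj G) i))
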